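{- For every positive integer $n$, \[ \mathcal{M}^{(1/2)}(n)=\Bigl\lfloor \frac{15n^2+72}{76}\Bigr\rfloor+\begin{cases}1,&\text{if } n\equiv 18\pmod{38}\text{ or } n\equiv 20\pmod{38},\\ -1,&\text{if } n\equiv 19\pmod{38},\\ 0,&\text{otherwise.}\end{cases} \]
   Context: For $n\in\mathbb{N}$ let $[n]=\{1,\dots,n\}$. For $a>0$ and integers $1\le s\le t\le n$, consider the coloring of $[n]$ in which $1,\dots,s$ and $t+1,\dots,n$ are red and $s+1,\dots,t$ are blue (written $R^sB^{t-s}R^{n-t}$). Define $\mathcal{M}^{(a)}(n,s,t)$ as the number of ordered pairs $(x,y)\in[n]^2$ such that the triple $T=(x,y,x+\lfloor ay\rfloor)$ lies in $[n]^3$ and either $T\in([s]\cup\{t+1,\dots,n\})^3$ or $T\in\{s+1,\dots,t\}^3$. Define $\mathcal{M}^{(a)}(n)=\min_{1\le s\le t\le n}\mathcal{M}^{(a)}(n,s,t)$; here $a=\tfrac12$, so the triples are $(x,y,x+\lfloor y/2\rfloor)$. -}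

module Defs where

open import Data.Nat using (ℕ; zero; suc; _+_; _*_; _≤_; _≤ᵇ_; _<ᵇ_; _/_; _%_)
open import Data.Bool using (Bool; true; false; _∧_; _∨_; not)
open import Data.List using (List; upTo; map; filterᵇ; length; concatMap)
open import Data.Integer using (ℤ; +_; -_)
open import Data.Product using (_×_; _,_; proj₁; proj₂)

range : ℕ → List ℕ
range n = map suc (upTo n)

inN : ℕ → ℕ → Bool
inN n z = (1 ≤ᵇ z) ∧ (z ≤ᵇ n)

-- red set for R^s B^(t-s) R^(n-t): [s] ∪ {t+1,…,n}
isRed : ℕ → ℕ → ℕ → ℕ → Bool
isRed n s t z = inN s z ∨ ((t <ᵇ z) ∧ (z ≤ᵇ n))

isBlue : ℕ → ℕ → ℕ → Bool
isBlue s t z = (s <ᵇ z) ∧ (z ≤ᵇ t)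

good : ℕ → ℕ → ℕ → ℕ → ℕ → Bool
good n s t x y =
  let w = x + y / 2 in
  inN n x ∧ inN n y ∧ inN n w ∧
  ((isRed n s t x ∧ isRed n s t y ∧ isRed n s t w) ∨
   (isBlue s t x ∧ isBlue s t y ∧ isBlue s t w))

pairs : ℕ → List (ℕ × ℕ)
pairs n = concatMap (λ x → map (λ y → x , y) (range n)) (range n)

M : ℕ → ℕ → ℕ → ℕ
M n s t = length (filterᵇ (λ p → good n s t (proj₁ p) (proj₂ p)) (pairs n))

corr : ℕ → ℤ
corr n with n % 38
... | 18 = + 1
... | 20 = + 1
... | 19 = - (+ 1)
... | _  = + 0

formula : ℕ → ℤ
formula n = + ((15 * n * n + 72) / 76) Data.Integer.+ corr n

{-# OPTIONS --safe #-}

-- Inclusion–exclusion over the colors of x, y and w = x + ⌊y/2⌋ expresses M n s t through the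
-- counts K q r = #{(x , y) : x ≥ 1, 1 ≤ y ≤ q, x + ⌊y/2⌋ ≤ r}, and K q r is r² or q r − ⌊q²/4⌋
-- according to whether 2r ≤ q or q ≤ 2r. In the region around the optimum this gives M = Q with
--   304 Q = 60 n² + u² + 19 v² + 76 (ρ s − ρ n),   u = 19s − 4n,   v = 8t − 5s − 4n,
-- where ρ is the parity; as u mod 152 and v mod 8 depend only on n mod 38 and s mod 8, the
-- minimum over the integers is a finite computation. Everywhere else K q r ≤ r² and
-- K q r ≥ q r − ⌊q²/4⌋ bound M from below by a quadratic form exceeding the minimum by a positive
-- multiple of n², which beats the rounding errors once n ≥ 13; smaller n are evaluated.
module Submission where

open import Defs
open import Data.Nat as N using (ℕ; zero; suc; s≤s; z≤n; _⊓_; _∸_; _≤ᵇ_; _<ᵇ_)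
import Data.Nat.Properties as NP
import Data.Nat.DivMod as DM
open import Data.Nat.Divisibility using (n∣m*n)
open import Data.Nat.Tactic.RingSolver using () renaming (solve-∀ to ℕ-solve-∀)
open import Data.Integer as Z using (ℤ; +_; -[1+_]; -_; _+_; _*_; _-_; 0ℤ; 1ℤ; -1ℤ; _≤_; +≤+)
import Data.Integer.Properties as ZP
open import Data.Integer.Tactic.RingSolver using (solve-∀)
open import Data.Bool using (Bool; true; false; _∧_; _∨_; not)
import Data.Bool.Properties as BP
open import Data.List using (List; []; _∷_; _++_; map; upTo; filterᵇ; length; concatMap)
import Data.List.Properties as LP
open import Data.List.Relation.Unary.All using (All; []; _∷_)
open import Data.Product using (Σ; ∃; _×_; _,_; proj₁; proj₂)
open import Data.Sum using (_⊎_; inj₁; inj₂)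
open import Function using (_∘_)
open import Function.Bundles using (Equivalence)
open import Relation.Nullary using (contradiction)
open import Relation.Nullary.Decidable using (Dec; from-yes; _×-dec_; _→-dec_; map′; True; toWitness)
open import Relation.Binary.PropositionalEquality using (_≡_; refl; sym; trans; cong; cong₂; subst; subst₂; module ≡-Reasoning)

-- Counting by inclusion–exclusion

-- The closed form of K changes at 2r = q, so M is only piecewise quadratic, and the estimates
-- switch at the walls t = e, s = d + e, d = s + e, t = 2e and s = 2e, where s, d, e are the block
-- lengths. Exact integer minimization is confined to the cell around (4, 8, 7) n / 19; the other
-- cells are excluded by their leading coefficient. The narrowest gap lies just across t = 2e: there
-- 4M is at least 79 n² / 99 - 1, and the leading form takes the value 79/99 at (8, 14, 11) n / 33
-- on the wall itself, against 15/19 at the minimum. In the remaining cells 4/5 is available. After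
-- scaling by 76 the gap is only 16 n² / 99, which sets the threshold 13. The exceptional residues
-- are lattice effects. If n ≡ 19 mod 38, then u = v = 0 is attainable with s even and n odd, and
-- the parity term puts M a quarter below 15 n² / 76. If n ≡ 18 or 20, the best choice has |u| = |v|
-- = 4, which costs 320/304 = 80/76, more than a whole unit.

ι : Bool → ℤ
ι true  = 1ℤ
ι false = 0ℤ

∑ : ℕ → (ℕ → ℤ) → ℤ
∑ zero    f = 0ℤ
∑ (suc n) f = ∑ n f + f (suc n)

∑-cong : ∀ n {f g} → (∀ i → 1 N.≤ i → i N.≤ n → f i ≡ g i) → ∑ n f ≡ ∑ n g
∑-cong zero    eq = refl
∑-cong (suc n) eq = cong₂ _+_ (∑-cong n λ i 1≤i i≤n → eq i 1≤i (NP.m≤n⇒m≤1+n i≤n)) (eq (suc n) (s≤s z≤n) NP.≤-refl)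

∑-zero : ∀ n → ∑ n (λ _ → 0ℤ) ≡ 0ℤ
∑-zero zero    = refl
∑-zero (suc n) = trans (ZP.+-identityʳ _) (∑-zero n)

∑-linear : ∀ n c f g → ∑ n (λ i → c * f i + g i) ≡ c * ∑ n f + ∑ n g
∑-linear zero    c f g = sym (trans (ZP.+-identityʳ _) (ZP.*-zeroʳ c))
∑-linear (suc n) c f g = trans (cong (_+ (c * f (suc n) + g (suc n))) (∑-linear n c f g)) (regroup c (∑ n f) (∑ n g) (f (suc n)) (g (suc n)))
  where
  regroup : ∀ c a b x y → c * a + b + (c * x + y) ≡ c * (a + x) + (b + y)
  regroup = solve-∀

∑-*ˡ : ∀ n c f → ∑ n (λ i → c * f i) ≡ c * ∑ n f
∑-*ˡ zero    c f = sym (ZP.*-zeroʳ c)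
∑-*ˡ (suc n) c f = trans (cong (_+ c * f (suc n)) (∑-*ˡ n c f)) (sym (ZP.*-distribˡ-+ c _ _))

≤ᵇ-true : ∀ {m n} → m N.≤ n → (m ≤ᵇ n) ≡ true
≤ᵇ-true m≤n = Equivalence.to BP.T-≡ (NP.≤⇒≤ᵇ m≤n)

≤ᵇ-false : ∀ {m n} → n N.< m → (m ≤ᵇ n) ≡ false
≤ᵇ-false {m} {n} n<m with m ≤ᵇ n in eq
... | false = refl
... | true  = contradiction (NP.≤ᵇ⇒≤ m n (Equivalence.from BP.T-≡ eq)) (NP.<⇒≱ n<m)

<ᵇ-true : ∀ {m n} → m N.< n → (m <ᵇ n) ≡ true
<ᵇ-true m<n = Equivalence.to BP.T-≡ (NP.<⇒<ᵇ m<n)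

<ᵇ-false : ∀ {m n} → n N.≤ m → (m <ᵇ n) ≡ false
<ᵇ-false {m} {n} n≤m with m <ᵇ n in eq
... | false = refl
... | true  = contradiction (NP.<ᵇ⇒< m n (Equivalence.from BP.T-≡ eq)) (NP.≤⇒≯ n≤m)

∑-truncate : ∀ {p n} → p N.≤ n → ∀ f → ∑ n (λ i → ι (i ≤ᵇ p) * f i) ≡ ∑ p f
∑-truncate {p} {n} p≤n f = trans (cong (λ m → ∑ m (λ i → ι (i ≤ᵇ p) * f i)) (sym (NP.m+[n∸m]≡n p≤n))) (go (n ∸ p))
  where
  go : ∀ k → ∑ (p N.+ k) (λ i → ι (i ≤ᵇ p) * f i) ≡ ∑ p f
  go zero    rewrite NP.+-identityʳ p = ∑-cong p λ i _ i≤p → trans (cong (λ b → ι b * f i) (≤ᵇ-true i≤p)) (ZP.*-identityˡ (f i))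
  go (suc k) rewrite NP.+-suc p k | ≤ᵇ-false (s≤s (NP.m≤m+n p k)) = trans (ZP.+-identityʳ _) (go k)

range-∷ʳ : ∀ n → range (suc n) ≡ range n ++ suc n ∷ []
range-∷ʳ n = trans (cong (map suc) (sym (LP.upTo-∷ʳ n))) (LP.map-++ suc (upTo n) (n ∷ []))

module _ {A : Set} (P : A → Bool) where

  count : List A → ℤ
  count xs = + length (filterᵇ P xs)

  count-++ : ∀ xs ys → count (xs ++ ys) ≡ count xs + count ys
  count-++ xs ys = cong +_ (trans (cong length (LP.filter-++ _ xs ys)) (LP.length-++ (filterᵇ P xs)))

  count-[_] : ∀ x → count (x ∷ []) ≡ ι (P x)
  count-[ x ] with P x
  ... | true  = refl
  ... | false = refl

  count-map-range : ∀ n (g : ℕ → A) → count (map g (range n)) ≡ ∑ n (ι ∘ P ∘ g)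
  count-map-range zero    g = refl
  count-map-range (suc n) g = begin
    count (map g (range (suc n)))              ≡⟨ cong (count ∘ map g) (range-∷ʳ n) ⟩
    count (map g (range n ++ suc n ∷ []))      ≡⟨ cong count (LP.map-++ g (range n) (suc n ∷ [])) ⟩
    count (map g (range n) ++ g (suc n) ∷ [])  ≡⟨ count-++ (map g (range n)) _ ⟩
    count (map g (range n)) + count (g (suc n) ∷ [])  ≡⟨ cong₂ _+_ (count-map-range n g) count-[ g (suc n) ] ⟩
    ∑ (suc n) (ι ∘ P ∘ g)  ∎
    where open ≡-Reasoning

  count-concatMap-range : ∀ n (g : ℕ → List A) → count (concatMap g (range n)) ≡ ∑ n (count ∘ g)
  count-concatMap-range zero    g = refl
  count-concatMap-range (suc n) g = begin
    count (concatMap g (range (suc n)))                        ≡⟨ cong (count ∘ concatMap g) (range-∷ʳ n) ⟩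
    count (concatMap g (range n ++ suc n ∷ []))                ≡⟨ cong count (LP.concatMap-++ g (range n) (suc n ∷ [])) ⟩
    count (concatMap g (range n) ++ g (suc n) ++ [])           ≡⟨ count-++ (concatMap g (range n)) _ ⟩
    count (concatMap g (range n)) + count (g (suc n) ++ [])    ≡⟨ cong₂ _+_ (count-concatMap-range n g) (cong count (LP.++-identityʳ (g (suc n)))) ⟩
    ∑ (suc n) (count ∘ g)  ∎
    where open ≡-Reasoning

M-as-∑ : ∀ n s t → + M n s t ≡ ∑ n (λ x → ∑ n (λ y → ι (good n s t x y)))
M-as-∑ n s t = trans (count-concatMap-range P n (λ x → map (x ,_) (range n))) (∑-cong n λ x _ _ → count-map-range P n (x ,_))
  where
  P : ℕ × ℕ → Bool
  P (x , y) = good n s t x y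

-- Summed over the rows x = r, r − 1, …, 1.
K : ℕ → ℕ → ℕ
K q zero    = 0
K q (suc r) = K q r N.+ (q ⊓ suc (2 N.* r))

row : ℕ → ℕ → ℕ → ℤ
row q r x = ∑ q (λ y → ι (x N.+ y N./ 2 ≤ᵇ r))

<⇒<suc/2 : ∀ {c q} → 2 N.* c N.< q → c N.< suc q N./ 2
<⇒<suc/2 {c} {q} 2c<q = subst (N._≤ suc q N./ 2) (DM.m*n/n≡m (suc c) 2)
  (DM./-monoˡ-≤ 2 (subst (N._≤ suc q) (trans (sym (NP.*-suc 2 c)) (NP.*-comm 2 (suc c))) (s≤s 2c<q)))

≤⇒suc/2≤ : ∀ {c q} → q N.≤ 2 N.* c → suc q N./ 2 N.≤ c
≤⇒suc/2≤ {c} {q} q≤2c = NP.<⇒≤pred (DM.m<n*o⇒m/o<n {suc q} {suc c} {2}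
  (subst (suc q N.<_) (trans (sym (NP.*-suc 2 c)) (NP.*-comm 2 (suc c))) (s≤s (s≤s q≤2c))))

-- Since ⌊y/2⌋ ≤ c exactly when y ≤ 2c + 1, row x of a count with r = x + c holds the first 2c + 1
-- values of y, cut off at q.
row-≤ : ∀ q x c → row q (x N.+ c) x ≡ + (q ⊓ suc (2 N.* c))
row-≤ zero    x c = refl
row-≤ (suc q) x c with NP.<-≤-connex (2 N.* c) q
... | inj₁ 2c<q rewrite row-≤ q x c | NP.m≥n⇒m⊓n≡n 2c<q | NP.m≥n⇒m⊓n≡n (NP.m≤n⇒m≤1+n 2c<q)
                      | ≤ᵇ-false {x N.+ suc q N./ 2} {x N.+ c} (NP.+-monoʳ-< x (<⇒<suc/2 2c<q)) = ZP.+-identityʳ _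
... | inj₂ q≤2c rewrite row-≤ q x c | NP.m≤n⇒m⊓n≡m (NP.m≤n⇒m≤1+n q≤2c) | NP.m≤n⇒m⊓n≡m q≤2c
                      | ≤ᵇ-true {x N.+ suc q N./ 2} {x N.+ c} (NP.+-monoʳ-≤ x (≤⇒suc/2≤ q≤2c)) = cong +_ (NP.+-comm q 1)

row-> : ∀ q {r x} → r N.< x → row q r x ≡ 0ℤ
row-> q {r} {x} r<x = trans (∑-cong q λ y _ _ → cong ι (≤ᵇ-false (NP.≤-trans r<x (NP.m≤m+n x (y N./ 2))))) (∑-zero q)

-- Translating x by p turns the rows beyond p into the rows of the same count with r - p in place of
-- r. For p ≥ r no such row is left, which truncated subtraction records as `K q 0`.
∑-row : ∀ q r p → ∑ p (row q r) + + K q (r ∸ p) ≡ + K q r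
∑-row q r zero    = ZP.+-identityˡ _
∑-row q r (suc p) with NP.<-≤-connex p r
... | inj₂ r≤p rewrite row-> q (s≤s r≤p) | NP.m≤n⇒m∸n≡0 (NP.m≤n⇒m≤1+n r≤p) =
  trans (cong (_+ 0ℤ) (ZP.+-identityʳ (∑ p (row q r)))) (subst (λ k → ∑ p (row q r) + + K q k ≡ + K q r) (NP.m≤n⇒m∸n≡0 r≤p) (∑-row q r p))
... | inj₁ p<r with c , refl ← NP.m≤n⇒∃[o]m+o≡n p<r = begin
  ∑ p (row q (suc p N.+ c)) + row q (suc p N.+ c) (suc p) + + K q (p N.+ c ∸ p)
    ≡⟨ cong₂ (λ a k → ∑ p (row q (suc p N.+ c)) + a + + K q k) (row-≤ q (suc p) c) (NP.m+n∸m≡n p c) ⟩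
  ∑ p (row q (suc p N.+ c)) + + (q ⊓ suc (2 N.* c)) + + K q c
    ≡⟨ ZP.+-assoc (∑ p (row q (suc p N.+ c))) _ _ ⟩
  ∑ p (row q (suc p N.+ c)) + + ((q ⊓ suc (2 N.* c)) N.+ K q c)
    ≡⟨ cong (λ k → ∑ p (row q (suc p N.+ c)) + + k) (NP.+-comm (q ⊓ suc (2 N.* c)) (K q c)) ⟩
  ∑ p (row q (suc p N.+ c)) + + K q (suc c)
    ≡⟨ cong (λ k → ∑ p (row q (suc p N.+ c)) + + K q k) (trans (sym (NP.m+n∸m≡n p (suc c))) (cong (_∸ p) (NP.+-suc p c))) ⟩
  ∑ p (row q (suc p N.+ c)) + + K q (suc p N.+ c ∸ p)
    ≡⟨ ∑-row q (suc p N.+ c) p ⟩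
  + K q (suc p N.+ c)  ∎
  where open ≡-Reasoning

W : ℕ → ℕ → ℕ → ℕ → ℕ → ℤ
W p q r x y = ι (x ≤ᵇ p) * (ι (y ≤ᵇ q) * ι (x N.+ y N./ 2 ≤ᵇ r))

∑∑ : ℕ → (ℕ → ℕ → ℤ) → ℤ
∑∑ n f = ∑ n (λ x → ∑ n (f x))

∑∑-W : ∀ {n p q} r → p N.≤ n → q N.≤ n → ∑∑ n (W p q r) ≡ + K q r - + K q (r ∸ p)
∑∑-W {n} {p} {q} r p≤n q≤n = begin
  ∑∑ n (W p q r)   ≡⟨ ∑-cong n (λ x _ _ → ∑-*ˡ n (ι (x ≤ᵇ p)) _) ⟩
  ∑ n (λ x → ι (x ≤ᵇ p) * ∑ n (λ y → ι (y ≤ᵇ q) * ι (x N.+ y N./ 2 ≤ᵇ r)))   ≡⟨ ∑-truncate p≤n _ ⟩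
  ∑ p (λ x → ∑ n (λ y → ι (y ≤ᵇ q) * ι (x N.+ y N./ 2 ≤ᵇ r)))   ≡⟨ ∑-cong p (λ x _ _ → ∑-truncate q≤n _) ⟩
  ∑ p (row q r)    ≡⟨ cancel (∑ p (row q r)) (+ K q (r ∸ p)) ⟩
  ∑ p (row q r) + + K q (r ∸ p) - + K q (r ∸ p)  ≡⟨ cong (_- + K q (r ∸ p)) (∑-row q r p) ⟩
  + K q r - + K q (r ∸ p)  ∎
  where
  open ≡-Reasoning
  cancel : ∀ a b → a ≡ a + b - b
  cancel = solve-∀

-- A formal linear combination of boxes (p , q , r). The same list is evaluated pointwise at `W`
-- and, after summation, at differences of `K`, so linearity of the double sum is proved once for
-- all terms.
combine : (ℕ → ℕ → ℕ → ℤ) → List (ℤ × ℕ × ℕ × ℕ) → ℤ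
combine Φ []                     = 0ℤ
combine Φ ((c , p , q , r) ∷ ts) = c * Φ p q r + combine Φ ts

combine-cong : ∀ {n Φ Ψ} → (∀ p q r → p N.≤ n → q N.≤ n → Φ p q r ≡ Ψ p q r) →
  ∀ {ts} → All (λ (_ , p , q , _) → p N.≤ n × q N.≤ n) ts → combine Φ ts ≡ combine Ψ ts
combine-cong eq []                    = refl
combine-cong eq (_∷_ {c , p , q , r} (p≤n , q≤n) bs) = cong₂ (λ a b → c * a + b) (eq p q r p≤n q≤n) (combine-cong eq bs)

∑∑-combine : ∀ n (Ψ : ℕ → ℕ → ℕ → ℕ → ℕ → ℤ) ts →
  ∑∑ n (λ x y → combine (λ p q r → Ψ p q r x y) ts) ≡ combine (λ p q r → ∑∑ n (Ψ p q r)) ts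
∑∑-combine n Ψ []                     = trans (∑-cong n λ _ _ _ → ∑-zero n) (∑-zero n)
∑∑-combine n Ψ ((c , p , q , r) ∷ ts) = begin
  ∑ n (λ x → ∑ n (λ y → c * Ψ p q r x y + combine (λ p q r → Ψ p q r x y) ts))
    ≡⟨ ∑-cong n (λ x _ _ → ∑-linear n c (Ψ p q r x) _) ⟩
  ∑ n (λ x → c * ∑ n (Ψ p q r x) + ∑ n (λ y → combine (λ p q r → Ψ p q r x y) ts))
    ≡⟨ ∑-linear n c _ _ ⟩
  c * ∑∑ n (Ψ p q r) + ∑∑ n (λ x y → combine (λ p q r → Ψ p q r x y) ts)
    ≡⟨ cong (λ a → c * ∑∑ n (Ψ p q r) + a) (∑∑-combine n Ψ ts) ⟩
  combine (λ p q r → ∑∑ n (Ψ p q r)) ((c , p , q , r) ∷ ts)  ∎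
  where open ≡-Reasoning

-- The expansion of 1 − β(x) − β(y) − β(w) + β(x)β(y) + β(y)β(w) + β(x)β(w), the indicator
-- of a monochromatic triple, where β(z) = [z ≤ t] − [z ≤ s] is the indicator of blue.
terms : ℕ → ℕ → ℕ → List (ℤ × ℕ × ℕ × ℕ)
terms n s t =
  (1ℤ , n , n , n) ∷
  (-1ℤ , t , n , n) ∷ (1ℤ , s , n , n) ∷
  (-1ℤ , n , t , n) ∷ (1ℤ , n , s , n) ∷
  (-1ℤ , n , n , t) ∷ (1ℤ , n , n , s) ∷
  (1ℤ , t , t , n) ∷ (-1ℤ , t , s , n) ∷ (-1ℤ , s , t , n) ∷ (1ℤ , s , s , n) ∷
  (1ℤ , n , t , t) ∷ (-1ℤ , n , t , s) ∷ (-1ℤ , n , s , t) ∷ (1ℤ , n , s , s) ∷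
  (1ℤ , t , n , t) ∷ (-1ℤ , t , n , s) ∷ (-1ℤ , s , n , t) ∷ (1ℤ , s , n , s) ∷ []

isRed≡not-isBlue : ∀ {n s t z} → s N.≤ t → 1 N.≤ z → z N.≤ n → isRed n s t z ≡ not (isBlue s t z)
isRed≡not-isBlue {n} {s} {t} {z} s≤t 1≤z z≤m with NP.<-≤-connex s z | NP.<-≤-connex t z
... | inj₂ z≤s | _        rewrite ≤ᵇ-true 1≤z | ≤ᵇ-true z≤s | <ᵇ-false z≤s = refl
... | inj₁ s<z | inj₁ t<z rewrite ≤ᵇ-false s<z | <ᵇ-true s<z | <ᵇ-true t<z | ≤ᵇ-false t<z | ≤ᵇ-true 1≤z | ≤ᵇ-true z≤m = refl
... | inj₁ s<z | inj₂ z≤t rewrite ≤ᵇ-false s<z | <ᵇ-true s<z | <ᵇ-false z≤t | ≤ᵇ-true z≤t | ≤ᵇ-true 1≤z = refl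

ι-isBlue : ∀ {s t} z → s N.≤ t → ι (isBlue s t z) ≡ ι (z ≤ᵇ t) - ι (z ≤ᵇ s)
ι-isBlue {s} {t} z s≤t with NP.<-≤-connex s z
... | inj₁ s<z rewrite <ᵇ-true s<z | ≤ᵇ-false s<z = sym (ZP.+-identityʳ _)
... | inj₂ z≤s rewrite <ᵇ-false z≤s | ≤ᵇ-true z≤s | ≤ᵇ-true (NP.≤-trans z≤s s≤t) = refl

ι-monochromatic : ∀ a b c → ι ((not a ∧ not b ∧ not c) ∨ (a ∧ b ∧ c)) ≡
  1ℤ - ι a - ι b - ι c + ι a * ι b + ι b * ι c + ι a * ι c
ι-monochromatic true  true  true  = refl
ι-monochromatic true  true  false = refl
ι-monochromatic true  false true  = refl
ι-monochromatic true  false false = refl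
ι-monochromatic false true  true  = refl
ι-monochromatic false true  false = refl
ι-monochromatic false false true  = refl
ι-monochromatic false false false = refl

module _ {n s t x y} (s≤t : s N.≤ t) (t≤n : t N.≤ n) (1≤x : 1 N.≤ x) (x≤n : x N.≤ n) (1≤y : 1 N.≤ y) (y≤n : y N.≤ n) where

  ι-good : ι (good n s t x y) ≡ combine (λ p q r → W p q r x y) (terms n s t)
  ι-good with NP.<-≤-connex n (x N.+ y N./ 2)
  -- A triple that leaves the interval must contribute 0: each term carries a factor [w ≤ r] with r
  -- ≤ n. This is why terms without a condition on the color of w still have r = n.
  ... | inj₁ n<w rewrite ≤ᵇ-true 1≤x | ≤ᵇ-true x≤n | ≤ᵇ-true 1≤y | ≤ᵇ-true y≤n
                       | ≤ᵇ-true (NP.≤-trans 1≤x (NP.m≤m+n x (y N./ 2)))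
                       | ≤ᵇ-false n<w | ≤ᵇ-false (NP.≤-trans (s≤s t≤n) n<w) | ≤ᵇ-false (NP.≤-trans (s≤s (NP.≤-trans s≤t t≤n)) n<w)
                       = zeros (ι (x ≤ᵇ s)) (ι (x ≤ᵇ t)) (ι (y ≤ᵇ s)) (ι (y ≤ᵇ t))
    where
    zeros : ∀ xs xt ys yt → 0ℤ ≡
      1ℤ * (1ℤ * (1ℤ * 0ℤ)) +
      (-1ℤ * (xt * (1ℤ * 0ℤ)) + (1ℤ * (xs * (1ℤ * 0ℤ)) +
      (-1ℤ * (1ℤ * (yt * 0ℤ)) + (1ℤ * (1ℤ * (ys * 0ℤ)) +
      (-1ℤ * (1ℤ * (1ℤ * 0ℤ)) + (1ℤ * (1ℤ * (1ℤ * 0ℤ)) +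
      (1ℤ * (xt * (yt * 0ℤ)) + (-1ℤ * (xt * (ys * 0ℤ)) + (-1ℤ * (xs * (yt * 0ℤ)) + (1ℤ * (xs * (ys * 0ℤ)) +
      (1ℤ * (1ℤ * (yt * 0ℤ)) + (-1ℤ * (1ℤ * (yt * 0ℤ)) + (-1ℤ * (1ℤ * (ys * 0ℤ)) + (1ℤ * (1ℤ * (ys * 0ℤ)) +
      (1ℤ * (xt * (1ℤ * 0ℤ)) + (-1ℤ * (xt * (1ℤ * 0ℤ)) + (-1ℤ * (xs * (1ℤ * 0ℤ)) + (1ℤ * (xs * (1ℤ * 0ℤ)) + 0ℤ))))))))))))))))))
    zeros = solve-∀
  ... | inj₂ w≤n rewrite isRed≡not-isBlue s≤t 1≤x x≤n | isRed≡not-isBlue s≤t 1≤y y≤n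
                       | isRed≡not-isBlue s≤t (NP.≤-trans 1≤x (NP.m≤m+n x (y N./ 2))) w≤n
                       | ≤ᵇ-true 1≤x | ≤ᵇ-true x≤n | ≤ᵇ-true 1≤y | ≤ᵇ-true y≤n
                       | ≤ᵇ-true (NP.≤-trans 1≤x (NP.m≤m+n x (y N./ 2))) | ≤ᵇ-true w≤n
                       | ι-monochromatic (isBlue s t x) (isBlue s t y) (isBlue s t (x N.+ y N./ 2))
                       | ι-isBlue x s≤t | ι-isBlue y s≤t | ι-isBlue (x N.+ y N./ 2) s≤t
                       = expand (ι (x ≤ᵇ s)) (ι (x ≤ᵇ t)) (ι (y ≤ᵇ s)) (ι (y ≤ᵇ t)) (ι (x N.+ y N./ 2 ≤ᵇ s)) (ι (x N.+ y N./ 2 ≤ᵇ t))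
    where
    expand : ∀ xs xt ys yt ws wt →
      1ℤ - (xt - xs) - (yt - ys) - (wt - ws) + (xt - xs) * (yt - ys) + (yt - ys) * (wt - ws) + (xt - xs) * (wt - ws) ≡
      1ℤ * (1ℤ * (1ℤ * 1ℤ)) +
      (-1ℤ * (xt * (1ℤ * 1ℤ)) + (1ℤ * (xs * (1ℤ * 1ℤ)) +
      (-1ℤ * (1ℤ * (yt * 1ℤ)) + (1ℤ * (1ℤ * (ys * 1ℤ)) +
      (-1ℤ * (1ℤ * (1ℤ * wt)) + (1ℤ * (1ℤ * (1ℤ * ws)) +
      (1ℤ * (xt * (yt * 1ℤ)) + (-1ℤ * (xt * (ys * 1ℤ)) + (-1ℤ * (xs * (yt * 1ℤ)) + (1ℤ * (xs * (ys * 1ℤ)) +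
      (1ℤ * (1ℤ * (yt * wt)) + (-1ℤ * (1ℤ * (yt * ws)) + (-1ℤ * (1ℤ * (ys * wt)) + (1ℤ * (1ℤ * (ys * ws)) +
      (1ℤ * (xt * (1ℤ * wt)) + (-1ℤ * (xt * (1ℤ * ws)) + (-1ℤ * (xs * (1ℤ * wt)) + (1ℤ * (xs * (1ℤ * ws)) + 0ℤ))))))))))))))))))
    expand = solve-∀

module _ (s d e : ℕ) where

  private
    t n : ℕ
    t = s N.+ d
    n = s N.+ d N.+ e

    k : ℕ → ℕ → ℤ
    k q r = + K q r

  -- The six counts in the first bracket have q ≤ r and hence one closed form throughout. The other
  -- ten depend on how the block lengths compare; they are paired into five differences, each of
  -- which is estimated as a unit.
  M-as-K : + M n s t ≡
    (k n n - k t n + k s n + k t t - k s t + k s s) +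
    (k n s - k n (d N.+ e)) + (k n e - k n t) + (k s e - k t e) + (k t (d N.+ e) - k s (d N.+ e)) + (k n d - k t s)
  M-as-K = begin
    + M n s t
      ≡⟨ M-as-∑ n s t ⟩
    ∑∑ n (λ x y → ι (good n s t x y))
      ≡⟨ ∑-cong n (λ x 1≤x x≤n → ∑-cong n (λ y 1≤y y≤n → ι-good s≤t t≤n 1≤x x≤n 1≤y y≤n)) ⟩
    ∑∑ n (λ x y → combine (λ p q r → W p q r x y) (terms n s t))
      ≡⟨ ∑∑-combine n W (terms n s t) ⟩
    combine (λ p q r → ∑∑ n (W p q r)) (terms n s t)
      ≡⟨ combine-cong count-W bounds ⟩
    combine (λ p q r → k q r - k q (r ∸ p)) (terms n s t)
      ≡⟨ differences ⟩
    _ ∎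
    where
    open ≡-Reasoning
    s≤t : s N.≤ t
    s≤t = NP.m≤m+n s d
    t≤n : t N.≤ n
    t≤n = NP.m≤m+n t e
    s≤n : s N.≤ n
    s≤n = NP.≤-trans s≤t t≤n
    n≤n : n N.≤ n
    n≤n = NP.≤-refl
    count-W : ∀ p q r → p N.≤ n → q N.≤ n → ∑∑ n (W p q r) ≡ k q r - k q (r ∸ p)
    count-W p q r p≤n q≤n = ∑∑-W r p≤n q≤n
    bounds : All (λ (_ , p , q , _) → p N.≤ n × q N.≤ n) (terms n s t)
    bounds =
      (n≤n , n≤n) ∷ (t≤n , n≤n) ∷ (s≤n , n≤n) ∷ (n≤n , t≤n) ∷ (n≤n , s≤n) ∷ (n≤n , n≤n) ∷ (n≤n , n≤n) ∷
      (t≤n , t≤n) ∷ (t≤n , s≤n) ∷ (s≤n , t≤n) ∷ (s≤n , s≤n) ∷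
      (n≤n , t≤n) ∷ (n≤n , t≤n) ∷ (n≤n , s≤n) ∷ (n≤n , s≤n) ∷
      (t≤n , n≤n) ∷ (t≤n , n≤n) ∷ (s≤n , n≤n) ∷ (s≤n , n≤n) ∷ []
    regroup : ∀ nn tn sn tt st ss ns nde ne nt se te tde sde nd ts →
      1ℤ * (nn - 0ℤ) + (-1ℤ * (nn - ne) + (1ℤ * (nn - nde) + (-1ℤ * (tn - 0ℤ) + (1ℤ * (sn - 0ℤ) + (-1ℤ * (nt - 0ℤ) + (1ℤ * (ns - 0ℤ) +
      (1ℤ * (tn - te) + (-1ℤ * (sn - se) + (-1ℤ * (tn - tde) + (1ℤ * (sn - sde) +
      (1ℤ * (tt - 0ℤ) + (-1ℤ * (ts - 0ℤ) + (-1ℤ * (st - 0ℤ) + (1ℤ * (ss - 0ℤ) + (1ℤ * (nt - 0ℤ) + (-1ℤ * (ns - 0ℤ) + (-1ℤ * (nt - nd) + (1ℤ * (ns - 0ℤ) + (0ℤ))))))))))))))))))) ≡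
      (nn - tn + sn + tt - st + ss) + (ns - nde) + (ne - nt) + (se - te) + (tde - sde) + (nd - ts)
    regroup = solve-∀
    differences : combine (λ p q r → k q r - k q (r ∸ p)) (terms n s t) ≡
      (k n n - k t n + k s n + k t t - k s t + k s s) +
      (k n s - k n (d N.+ e)) + (k n e - k n t) + (k s e - k t e) + (k t (d N.+ e) - k s (d N.+ e)) + (k n d - k t s)
    differences rewrite NP.n∸n≡0 n | NP.n∸n≡0 t | NP.n∸n≡0 s | NP.m≤n⇒m∸n≡0 t≤n | NP.m≤n⇒m∸n≡0 s≤n | NP.m≤n⇒m∸n≡0 s≤t
      | NP.m+n∸m≡n t e | NP.m+n∸m≡n s d | trans (cong (_∸ s) (NP.+-assoc s d e)) (NP.m+n∸m≡n s (d N.+ e)) =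
      regroup (k n n) (k t n) (k s n) (k t t) (k s t) (k s s) (k n s) (k n (d N.+ e)) (k n e) (k n t) (k s e) (k t e) (k t (d N.+ e)) (k s (d N.+ e)) (k n d) (k t s)

-- Closed forms and bounds for K

-- Recursion in steps of two adds q + 1 to ⌊q²/4⌋ regardless of parity, so inductions avoid both
-- division and a parity split.
⌊_²/4⌋ : ℕ → ℕ
⌊ zero ²/4⌋        = 0
⌊ suc zero ²/4⌋    = 0
⌊ suc (suc q) ²/4⌋ = suc (q N.+ ⌊ q ²/4⌋)

quarter-bounds : ∀ q → 4 N.* ⌊ q ²/4⌋ N.≤ q N.* q × q N.* q N.≤ suc (4 N.* ⌊ q ²/4⌋)
quarter-bounds zero          = z≤n , z≤n
quarter-bounds (suc zero)    = z≤n , s≤s z≤n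
quarter-bounds (suc (suc q)) with l , u ← quarter-bounds q =
  subst₂ N._≤_ (lower q ⌊ q ²/4⌋) (square q) (NP.+-monoˡ-≤ (4 N.+ 4 N.* q) l) ,
  subst₂ N._≤_ (square q) (upper q ⌊ q ²/4⌋) (NP.+-monoˡ-≤ (4 N.+ 4 N.* q) u)
  where
  lower : ∀ q h → 4 N.* h N.+ (4 N.+ 4 N.* q) ≡ 4 N.* suc (q N.+ h)
  lower = ℕ-solve-∀
  square : ∀ q → q N.* q N.+ (4 N.+ 4 N.* q) ≡ suc (suc q) N.* suc (suc q)
  square = ℕ-solve-∀
  upper : ∀ q h → suc (4 N.* h) N.+ (4 N.+ 4 N.* q) ≡ suc (4 N.* suc (q N.+ h))
  upper = ℕ-solve-∀

quarter-shift : ∀ r c → ⌊ r N.+ r N.+ c ²/4⌋ ≡ r N.* r N.+ r N.* c N.+ ⌊ c ²/4⌋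
quarter-shift zero    c = refl
quarter-shift (suc r) c rewrite NP.+-suc r r =
  trans (cong (λ h → suc (r N.+ r N.+ c N.+ h)) (quarter-shift r c)) (step r c ⌊ c ²/4⌋)
  where
  step : ∀ r c h → suc (r N.+ r N.+ c N.+ (r N.* r N.+ r N.* c N.+ h)) ≡ suc r N.* suc r N.+ suc r N.* c N.+ h
  step = ℕ-solve-∀

quarter-mono : ∀ c d → ⌊ c ²/4⌋ N.≤ ⌊ c N.+ d ²/4⌋
quarter-mono zero          d = z≤n
quarter-mono (suc zero)    d = z≤n
quarter-mono (suc (suc c)) d = s≤s (NP.+-mono-≤ (NP.m≤m+n c d) (quarter-mono c d))

double : ∀ r → 2 N.* r ≡ r N.+ r
double r = cong (r N.+_) (NP.+-identityʳ r)

suc-square : ∀ r → r N.* r N.+ suc (2 N.* r) ≡ suc r N.* suc r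
suc-square = ℕ-solve-∀

K≤r² : ∀ q r → K q r N.≤ r N.* r
K≤r² q zero    = z≤n
K≤r² q (suc r) = subst (K q (suc r) N.≤_) (suc-square r) (NP.+-mono-≤ (K≤r² q r) (NP.m⊓n≤n q _))

K≡r² : ∀ {q} r → r N.+ r N.≤ suc q → K q r ≡ r N.* r
K≡r² zero    _  = refl
K≡r² {q} (suc r) 2r≤q+1 = trans (cong₂ N._+_
  (K≡r² r (NP.≤-trans (NP.m≤n+m (r N.+ r) 2) (NP.≤-trans (NP.≤-reflexive (cong suc (sym (NP.+-suc r r)))) 2r≤q+1)))
  (NP.m≥n⇒m⊓n≡n 2r+1≤q)) (suc-square r)
  where
  2r+1≤q : suc (2 N.* r) N.≤ q
  2r+1≤q = subst (N._≤ q) (trans (NP.+-suc r r) (cong suc (sym (double r)))) (NP.≤-pred 2r≤q+1)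

-- Induction on r: the new row is full when q ≤ 2r + 1, which is exactly the hypothesis for the
-- previous r. The two closed forms agree whenever q and 2r differ by at most 1, and that overlap
-- starts the induction.
K≡qr : ∀ {q} r → q N.≤ suc (r N.+ r) → K q r N.+ ⌊ q ²/4⌋ ≡ q N.* r
K≡qr {zero}     zero _ = refl
K≡qr {suc zero} zero _ = refl
K≡qr {suc (suc _)} zero (s≤s ())
K≡qr {q} (suc r) q≤2r+3 with NP.≤-<-connex q (suc (r N.+ r))
... | inj₁ q≤2r+1 = begin
  K q r N.+ (q ⊓ suc (2 N.* r)) N.+ ⌊ q ²/4⌋ ≡⟨ cong (λ a → K q r N.+ a N.+ ⌊ q ²/4⌋) (NP.m≤n⇒m⊓n≡m (subst (λ a → q N.≤ suc a) (sym (double r)) q≤2r+1)) ⟩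
  K q r N.+ q N.+ ⌊ q ²/4⌋ ≡⟨ swap (K q r) q ⌊ q ²/4⌋ ⟩
  q N.+ (K q r N.+ ⌊ q ²/4⌋) ≡⟨ cong (q N.+_) (K≡qr r q≤2r+1) ⟩
  q N.+ q N.* r ≡⟨ NP.*-suc q r ⟨
  q N.* suc r ∎
  where
  open ≡-Reasoning
  swap : ∀ a b c → a N.+ b N.+ c ≡ b N.+ (a N.+ c)
  swap = ℕ-solve-∀
-- Here q is 2(r + 1) or 2(r + 1) + 1, inside the overlap, so the square form supplies the value.
... | inj₂ 2r+1<q with c , refl ← NP.m≤n⇒∃[o]m+o≡n 2r+1<q = begin
  K q (suc r) N.+ ⌊ q ²/4⌋ ≡⟨ cong (N._+ ⌊ q ²/4⌋) (K≡r² (suc r) (subst (N._≤ suc q) (cong suc (sym (NP.+-suc r r))) (NP.m≤n⇒m≤1+n (NP.m≤m+n (suc (suc (r N.+ r))) c)))) ⟩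
  suc r N.* suc r N.+ ⌊ q ²/4⌋ ≡⟨ cong (λ a → suc r N.* suc r N.+ ⌊ a N.+ c ²/4⌋) (cong suc (sym (NP.+-suc r r))) ⟩
  suc r N.* suc r N.+ ⌊ suc r N.+ suc r N.+ c ²/4⌋ ≡⟨ cong (suc r N.* suc r N.+_) (quarter-shift (suc r) c) ⟩
  suc r N.* suc r N.+ (suc r N.* suc r N.+ suc r N.* c N.+ ⌊ c ²/4⌋) ≡⟨ cong (λ a → suc r N.* suc r N.+ (suc r N.* suc r N.+ suc r N.* c N.+ a)) (⌊≤1⌋ c c≤1) ⟩
  suc r N.* suc r N.+ (suc r N.* suc r N.+ suc r N.* c N.+ 0) ≡⟨ collect r c ⟩
  q N.* suc r ∎
  where
  open ≡-Reasoning
  c≤1 : c N.≤ 1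
  c≤1 = NP.+-cancelˡ-≤ (suc (suc (r N.+ r))) c 1 (subst (suc (suc (r N.+ r)) N.+ c N.≤_) (bound r) q≤2r+3)
    where
    bound : ∀ r → suc (suc r N.+ suc r) ≡ suc (suc (r N.+ r)) N.+ 1
    bound = ℕ-solve-∀
  ⌊≤1⌋ : ∀ c → c N.≤ 1 → ⌊ c ²/4⌋ ≡ 0
  ⌊≤1⌋ zero _ = refl
  ⌊≤1⌋ (suc zero) _ = refl
  ⌊≤1⌋ (suc (suc c)) (s≤s ())
  collect : ∀ r c → suc r N.* suc r N.+ (suc r N.* suc r N.+ suc r N.* c N.+ 0) ≡ (suc (suc (r N.+ r)) N.+ c) N.* suc r
  collect = ℕ-solve-∀

-- The excess of K q r over q r - ⌊q²/4⌋ is 0 for q ≤ 2r and ⌊a²/4⌋ for q = 2r + a, hence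
-- nondecreasing in q. This bounds the difference `K t (d + e) − K s (d + e)` uniformly in all
-- regions.
K-increment : ∀ q c r → c N.* r N.+ (K q r N.+ ⌊ q ²/4⌋) N.≤ K (q N.+ c) r N.+ ⌊ q N.+ c ²/4⌋
K-increment q c r with NP.≤-total (q N.+ c) (r N.+ r) | NP.≤-total (r N.+ r) q
... | inj₁ q+c≤2r | _ = NP.≤-reflexive (begin
  c N.* r N.+ (K q r N.+ ⌊ q ²/4⌋)  ≡⟨ cong (c N.* r N.+_) (K≡qr r (NP.m≤n⇒m≤1+n (NP.≤-trans (NP.m≤m+n q c) q+c≤2r))) ⟩
  c N.* r N.+ q N.* r               ≡⟨ NP.+-comm (c N.* r) _ ⟩
  q N.* r N.+ c N.* r               ≡⟨ NP.*-distribʳ-+ r q c ⟨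
  (q N.+ c) N.* r                   ≡⟨ K≡qr r (NP.m≤n⇒m≤1+n q+c≤2r) ⟨
  K (q N.+ c) r N.+ ⌊ q N.+ c ²/4⌋  ∎)
  where open ≡-Reasoning
... | inj₂ 2r≤q+c | inj₁ 2r≤q with a , refl ← NP.m≤n⇒∃[o]m+o≡n 2r≤q
  rewrite K≡r² {r N.+ r N.+ a} r (NP.m≤n⇒m≤1+n 2r≤q) | K≡r² {r N.+ r N.+ a N.+ c} r (NP.m≤n⇒m≤1+n 2r≤q+c)
        | NP.+-assoc (r N.+ r) a c | quarter-shift r a | quarter-shift r (a N.+ c) =
  subst₂ N._≤_ (left r a c ⌊ a ²/4⌋) (right r a c ⌊ a N.+ c ²/4⌋) (NP.+-monoʳ-≤ (r N.* r N.+ r N.* r N.+ r N.* a N.+ r N.* c) (quarter-mono a c))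
  where
  left : ∀ r a c h → r N.* r N.+ r N.* r N.+ r N.* a N.+ r N.* c N.+ h ≡ c N.* r N.+ (r N.* r N.+ (r N.* r N.+ r N.* a N.+ h))
  left = ℕ-solve-∀
  right : ∀ r a c h → r N.* r N.+ r N.* r N.+ r N.* a N.+ r N.* c N.+ h ≡ r N.* r N.+ (r N.* r N.+ r N.* (a N.+ c) N.+ h)
  right = ℕ-solve-∀
... | inj₂ 2r≤q+c | inj₂ q≤2r with a , 2r+a≡q+c ← NP.m≤n⇒∃[o]m+o≡n 2r≤q+c
  rewrite K≡r² {q N.+ c} r (NP.m≤n⇒m≤1+n 2r≤q+c) | K≡qr {q} r (NP.m≤n⇒m≤1+n q≤2r) | sym 2r+a≡q+c | quarter-shift r a =
  NP.≤-trans (NP.≤-reflexive (trans (trans (NP.+-comm (c N.* r) _) (sym (NP.*-distribʳ-+ r q c))) (trans (cong (N._* r) (sym 2r+a≡q+c)) (collect r a))))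
    (NP.+-monoʳ-≤ (r N.* r) (NP.m≤m+n (r N.* r N.+ r N.* a) ⌊ a ²/4⌋))
  where
  collect : ∀ r a → (r N.+ r N.+ a) N.* r ≡ r N.* r N.+ (r N.* r N.+ r N.* a)
  collect = ℕ-solve-∀

qr≤K : ∀ q r → q N.* r N.≤ K q r N.+ ⌊ q ²/4⌋
qr≤K q r = NP.≤-trans (NP.m≤m+n (q N.* r) _) (K-increment 0 q r)

-- Quadratic lower bounds

k : ℕ → ℕ → ℤ
k q r = + K q r

h : ℕ → ℤ
h q = + ⌊ q ²/4⌋

add-sub : ∀ a b → a + b - b ≡ a
add-sub = solve-∀

-mono-≤ : ∀ {a b c d} → a ≤ b → c ≤ d → a - d ≤ b - c
-mono-≤ a≤b c≤d = ZP.+-mono-≤ a≤b (ZP.neg-mono-≤ c≤d)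

k≤r² : ∀ q r → k q r ≤ + r * + r
k≤r² q r = subst (k q r ≤_) (ZP.pos-* r r) (+≤+ (K≤r² q r))

k≡r² : ∀ {q} r → r N.+ r N.≤ suc q → k q r ≡ + r * + r
k≡r² r p = trans (cong +_ (K≡r² r p)) (ZP.pos-* r r)

qr-h≤k : ∀ q r → + q * + r - h q ≤ k q r
qr-h≤k q r = subst₂ _≤_ (cong (_- h q) (ZP.pos-* q r)) (add-sub (k q r) (h q)) (ZP.+-monoˡ-≤ (- h q) (+≤+ (qr≤K q r)))

k≡qr-h : ∀ {q} r → q N.≤ suc (r N.+ r) → k q r ≡ + q * + r - h q
k≡qr-h {q} r p = trans (sym (add-sub (k q r) (h q))) (cong (_- h q) (trans (cong +_ (K≡qr r p)) (ZP.pos-* q r)))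

k-increment : ∀ q c r → + c * + r - h (q N.+ c) + h q ≤ k (q N.+ c) r - k q r
k-increment q c r = ZP.0≤i-j⇒j≤i (subst (0ℤ ≤_) (trans (cong (λ a → k (q N.+ c) r + h (q N.+ c) - (a + (k q r + h q))) (ZP.pos-* c r))
  (regroup (k (q N.+ c) r) (h (q N.+ c)) (+ c * + r) (k q r) (h q)))
  (ZP.i≤j⇒0≤j-i (+≤+ (K-increment q c r))))
  where
  regroup : ∀ K' h' m K h → K' + h' - (m + (K + h)) ≡ K' - K - (m - h' + h)
  regroup = solve-∀

infixl 6 _⊕_
infixl 7 _⊗_

_⊕_ : ∀ {a b} → 0ℤ ≤ a → 0ℤ ≤ b → 0ℤ ≤ a + b
_⊕_ = ZP.+-mono-≤

_⊗_ : ∀ {a b} → 0ℤ ≤ a → 0ℤ ≤ b → 0ℤ ≤ a * b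
_⊗_ {+ a} {+ b} _ _ = subst (0ℤ ≤_) (ZP.pos-* a b) (+≤+ z≤n)

0≤+ : ∀ n → 0ℤ ≤ + n
0≤+ n = +≤+ z≤n

0≤z² : ∀ z → 0ℤ ≤ z * z
0≤z² (+ n)    = 0≤+ n ⊗ 0≤+ n
0≤z² -[1+ n ] = +≤+ z≤n

0≤q²-4h : ∀ q → 0ℤ ≤ + q * + q - + 4 * h q
0≤q²-4h q = ZP.i≤j⇒0≤j-i (subst₂ _≤_ (ZP.pos-* 4 ⌊ q ²/4⌋) (ZP.pos-* q q) (+≤+ (proj₁ (quarter-bounds q))))

0≤1-q²+4h : ∀ q → 0ℤ ≤ + 1 - (+ q * + q - + 4 * h q)
0≤1-q²+4h q = subst (0ℤ ≤_) (regroup (+ q * + q) (+ 4 * h q))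
  (ZP.i≤j⇒0≤j-i (subst₂ _≤_ (ZP.pos-* q q) (cong (λ a → 1ℤ + a) (ZP.pos-* 4 ⌊ q ²/4⌋)) (+≤+ (proj₂ (quarter-bounds q)))))
  where
  regroup : ∀ a b → + 1 + b - a ≡ + 1 - (a - b)
  regroup = solve-∀

0≤n²-169 : ∀ {n} → 13 N.≤ n → 0ℤ ≤ + n * + n - + 169
0≤n²-169 {n} 13≤n = ZP.i≤j⇒0≤j-i (subst (+ 169 ≤_) (ZP.pos-* n n) (+≤+ (NP.*-mono-≤ 13≤n 13≤n)))

scaled : ∀ κ {z} → 0ℤ ≤ + suc κ * z → 0ℤ ≤ z
scaled κ {z} 0≤κz = ZP.*-cancelˡ-≤-pos 0ℤ z (+ suc κ) (subst (_≤ + suc κ * z) (sym (ZP.*-zeroʳ (+ suc κ))) 0≤κz)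

-- In the coloring with block lengths s, d, e write T = s + d and N = s + d + e. The counts
-- K q r that are not determined by s ≤ T ≤ N are estimated by r² or by q r − ⌊q²/4⌋.
module Estimates (s d e hN hs hT : ℤ) where

  T N : ℤ
  T = s + d
  N = s + d + e

  -- The letters A, B, C stand for `k n s - k n (d + e)`, `k n e - k n t`, `k s e - k t e`, and G
  -- for `k n d`. Index 1 is the exact value on the side of the wall that contains the optimum;
  -- higher indices are lower bounds for the other sides.
  A₁ A₂ B₁ B₂ C₁ C₂ C₃ G₁ G₂ : ℤ
  A₁ = s * s - (N * (d + e) - hN)
  A₂ = N * s - hN - (d + e) * (d + e)
  B₁ = e * e - (N * T - hN)
  B₂ = N * e - hN - T * T
  C₁ = s * e - hs - (T * e - hT)
  C₂ = s * e - hs - e * e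
  C₃ = e * e - e * e
  G₁ = d * d
  G₂ = N * d - hN

  base : ℤ
  base = N * N - hN - (T * N - hT) + (s * N - hs) + (T * T - hT) - (s * T - hs) + (s * s - hs)

  bound : ℤ → ℤ → ℤ → ℤ → ℤ
  bound a b c g = base + a + b + c + (d * (d + e) - hT + hs) + (g - s * s)

  -- 79/99 exceeds 15/19 by just enough to absorb the parity corrections when N ≥ 13.
  Ample : ℤ → Set
  Ample b = 0ℤ ≤ + 99 * (+ 4 * b + + 1) - + 79 * (N * N)

  Q : ℤ
  Q = N * N + + 2 * (N * s) - + 4 * (N * T) + + 4 * (T * T) + + 3 * (s * s) - + 5 * (s * T) + hN - hs

bound-Q : ∀ s d e hn hs ht → let t = s + d; n = s + d + e in
  ((n * n - hn - (t * n - ht) + (s * n - hs) + (t * t - ht) - (s * t - hs) + (s * s - hs))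
      + (s * s - (n * (d + e) - hn)) + (e * e - (n * t - hn)) + (s * e - hs - (t * e - ht))
      + (d * (d + e) - ht + hs) + (d * d - s * s)) ≡
  n * n + + 2 * (n * s) - + 4 * (n * t) + + 4 * (t * t) + + 3 * (s * s) - + 5 * (s * t) + hn - hs
bound-Q = solve-∀

-- Quadratic forms outside the optimal cell

module Regions (s d e hN hs hT : ℤ) (0≤s : 0ℤ ≤ s) (0≤d : 0ℤ ≤ d) (0≤e : 0ℤ ≤ e) where
  open Estimates s d e hN hs hT

  module _ (0≤δN : 0ℤ ≤ N * N - + 4 * hN) (0≤1-δN : 0ℤ ≤ + 1 - (N * N - + 4 * hN))
           (0≤δs : 0ℤ ≤ s * s - + 4 * hs) (0≤δT : 0ℤ ≤ T * T - + 4 * hT) where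

    private
      -- X is 4b with each ⌊q²/4⌋ replaced by q²/4, and Δ collects the parities q² - 4⌊q²/4⌋. Only
      -- the parity of N ever enters Δ negatively, so Δ ≥ -1, and the + 1 in `Ample` absorbs it.
      ample : ∀ {b X Δ} → + 4 * b ≡ X + Δ → 0ℤ ≤ + 1 + Δ → 0ℤ ≤ + 99 * X - + 79 * (N * N) → Ample b
      ample {b} {X} {Δ} eq 0≤1+Δ 0≤99X-79N² = subst (λ z → 0ℤ ≤ + 99 * (z + + 1) - + 79 * (N * N)) (sym eq)
        (subst (0ℤ ≤_) (split X Δ (N * N)) (0≤99X-79N² ⊕ 0≤+ 99 ⊗ 0≤1+Δ))
        where
        split : ∀ X Δ m → + 99 * X - + 79 * m + + 99 * (+ 1 + Δ) ≡ + 99 * (X + Δ + + 1) - + 79 * m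
        split = solve-∀

      -- 4/5 exceeds 79/99 by 1/495, so where X stays above 4/5 N² the smaller constant follows at
      -- once and the certificates keep small coefficients.
      four-fifths : ∀ {X c} → + 5 * X ≡ + 4 * (N * N) + c → 0ℤ ≤ c → 0ℤ ≤ + 99 * X - + 79 * (N * N)
      four-fifths {X} {c} eq 0≤c = scaled 4 (subst (0ℤ ≤_) (trans (weaken (N * N) c) (trans (cong (λ z → + 99 * z - + 5 * (+ 79 * (N * N))) (sym eq)) (collect X (N * N))))
        (0≤+ 99 ⊗ 0≤c ⊕ 0≤z² N))
        where
        weaken : ∀ m c → + 99 * c + m ≡ + 99 * (+ 4 * m + c) - + 5 * (+ 79 * m)
        weaken = solve-∀
        collect : ∀ X m → + 99 * (+ 5 * X) - + 5 * (+ 79 * m) ≡ + 5 * (+ 99 * X - + 79 * m)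
        collect = solve-∀

    -- The region is a cone. Written in s, d and the slack f = e - T, the excess of 5X over 4 N² is
    -- a square plus products of nonnegative quantities. The other cones are certified in the same
    -- way with their own slacks.
    late-red-dominant : T ≤ e → Ample (bound A₁ B₂ C₁ G₁)
    late-red-dominant t≤e = ample {X = + 3 * (N * N) + + 8 * (N * s) - + 8 * (N * T) + + 8 * (T * T) + + 11 * (s * s) - + 20 * (s * T)}
      (identity₁ s d e hN hs hT)
      (0≤+ 1 ⊕ (0≤δN ⊕ 0≤δs))
      (four-fifths (identity₂ s d e)
        (0≤z² (+ 2 * d - + 3 * s)
        ⊕ 0≤+ 30 ⊗ (0≤s ⊗ 0≤s)
        ⊕ 0≤+ 44 ⊗ (0≤s ⊗ 0≤f)
        ⊕ 0≤+ 4 ⊗ (0≤d ⊗ 0≤f)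
        ⊕ 0≤+ 11 ⊗ (0≤f ⊗ 0≤f)))
      where
      0≤f : 0ℤ ≤ e - T
      0≤f = ZP.i≤j⇒0≤j-i t≤e
      identity₁ : ∀ s d e hn hs ht → let t = s + d; n = s + d + e in
        + 4 * ((n * n - hn - (t * n - ht) + (s * n - hs) + (t * t - ht) - (s * t - hs) + (s * s - hs))
            + (s * s - (n * (d + e) - hn)) + (n * e - hn - t * t) + (s * e - hs - (t * e - ht))
            + (d * (d + e) - ht + hs) + (d * d - s * s)) ≡
        + 3 * (n * n) + + 8 * (n * s) - + 8 * (n * t) + + 8 * (t * t) + + 11 * (s * s) - + 20 * (s * t) + ((n * n - + 4 * hn) + (s * s - + 4 * hs))
      identity₁ = solve-∀
      identity₂ : ∀ s d e → let t = s + d; n = s + d + e; f = e - t in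
        + 5 * (+ 3 * (n * n) + + 8 * (n * s) - + 8 * (n * t) + + 8 * (t * t) + + 11 * (s * s) - + 20 * (s * t)) ≡
        + 4 * (n * n) + ((+ 2 * d - + 3 * s) * (+ 2 * d - + 3 * s) + + 30 * (s * s) + + 44 * (s * f) + + 4 * (d * f) + + 11 * (f * f))
      identity₂ = solve-∀

    early-red-dominant-late-red-short : d + e ≤ s → Ample (bound A₂ B₁ C₃ G₁)
    early-red-dominant-late-red-short d+e≤s = ample {X = + 3 * (N * N) - + 12 * (N * d) + + 4 * (s * d) + + 12 * (d * d) - (s - d) * (s - d)}
      (identity₁ s d e hN hs hT)
      (0≤+ 1 ⊕ (0≤δN ⊕ 0≤δT))
      (four-fifths (identity₂ s d e)
        (0≤z² (+ 2 * d - + 3 * e)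
        ⊕ 0≤+ 30 ⊗ (0≤e ⊗ 0≤e)
        ⊕ 0≤+ 4 ⊗ (0≤d ⊗ 0≤f)
        ⊕ 0≤+ 34 ⊗ (0≤e ⊗ 0≤f)
        ⊕ 0≤+ 6 ⊗ (0≤f ⊗ 0≤f)))
      where
      0≤f : 0ℤ ≤ s - (d + e)
      0≤f = ZP.i≤j⇒0≤j-i d+e≤s
      identity₁ : ∀ s d e hn hs ht → let t = s + d; n = s + d + e in
        + 4 * ((n * n - hn - (t * n - ht) + (s * n - hs) + (t * t - ht) - (s * t - hs) + (s * s - hs))
            + (n * s - hn - (d + e) * (d + e)) + (e * e - (n * t - hn)) + (e * e - e * e)
            + (d * (d + e) - ht + hs) + (d * d - s * s)) ≡
        + 3 * (n * n) - + 12 * (n * d) + + 4 * (s * d) + + 12 * (d * d) - (s - d) * (s - d) + ((n * n - + 4 * hn) + (t * t - + 4 * ht))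
      identity₁ = solve-∀
      identity₂ : ∀ s d e → let t = s + d; n = s + d + e; f = s - (d + e) in
        + 5 * (+ 3 * (n * n) - + 12 * (n * d) + + 4 * (s * d) + + 12 * (d * d) - (s - d) * (s - d)) ≡
        + 4 * (n * n) + ((+ 2 * d - + 3 * e) * (+ 2 * d - + 3 * e) + + 30 * (e * e) + + 4 * (d * f) + + 34 * (e * f) + + 6 * (f * f))
      identity₂ = solve-∀

    early-red-dominant-late-red-long : d + e ≤ s → s ≤ e + e → Ample (bound A₂ B₁ C₂ G₁)
    early-red-dominant-late-red-long d+e≤s s≤2e = ample {X = + 12 * (N * s) - N * N - + 4 * (N * d) - + 10 * (s * s) - + 6 * (s * d) + + 7 * (d * d)}
      (identity₁ s d e hN hs hT)
      (0≤+ 1 ⊕ (0≤δN ⊕ 0≤δs ⊕ 0≤δT))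
      (four-fifths (identity₂ s d e)
        (0≤+ 31 ⊗ (0≤d ⊗ 0≤d)
        ⊕ 0≤+ 79 ⊗ (0≤f ⊗ 0≤f)
        ⊕ 0≤+ 34 ⊗ (0≤g ⊗ 0≤g)
        ⊕ 0≤+ 104 ⊗ (0≤d ⊗ 0≤f)
        ⊕ 0≤+ 66 ⊗ (0≤d ⊗ 0≤g)
        ⊕ 0≤+ 112 ⊗ (0≤f ⊗ 0≤g)))
      where
      0≤f : 0ℤ ≤ s - (d + e)
      0≤f = ZP.i≤j⇒0≤j-i d+e≤s
      0≤g : 0ℤ ≤ e + e - s
      0≤g = ZP.i≤j⇒0≤j-i s≤2e
      identity₁ : ∀ s d e hn hs ht → let t = s + d; n = s + d + e in
        + 4 * ((n * n - hn - (t * n - ht) + (s * n - hs) + (t * t - ht) - (s * t - hs) + (s * s - hs))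
            + (n * s - hn - (d + e) * (d + e)) + (e * e - (n * t - hn)) + (s * e - hs - e * e)
            + (d * (d + e) - ht + hs) + (d * d - s * s)) ≡
        + 12 * (n * s) - n * n - + 4 * (n * d) - + 10 * (s * s) - + 6 * (s * d) + + 7 * (d * d) + ((n * n - + 4 * hn) + (s * s - + 4 * hs) + (t * t - + 4 * ht))
      identity₁ = solve-∀
      identity₂ : ∀ s d e → let t = s + d; n = s + d + e; f = s - (d + e); g = e + e - s in
        + 5 * (+ 12 * (n * s) - n * n - + 4 * (n * d) - + 10 * (s * s) - + 6 * (s * d) + + 7 * (d * d)) ≡
        + 4 * (n * n) + (+ 31 * (d * d) + + 79 * (f * f) + + 34 * (g * g) + + 104 * (d * f) + + 66 * (d * g) + + 112 * (f * g))
      identity₂ = solve-∀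

    blue-dominant-late-red-long : s + e ≤ d → T ≤ e + e → Ample (bound A₁ B₁ C₁ G₂)
    blue-dominant-late-red-long s+e≤d t≤2e = ample {X = + 4 * (N * N) + + 4 * (N * s) - + 12 * (N * T) + + 12 * (T * T) + + 7 * (s * s) - + 12 * (s * T)}
      (identity₁ s d e hN hs hT)
      (0≤+ 1 ⊕ (0≤δs))
      (four-fifths (identity₂ s d e)
        (0≤+ 11 ⊗ (0≤s ⊗ 0≤s)
        ⊕ 0≤+ 24 ⊗ (0≤f ⊗ 0≤f)
        ⊕ 0≤+ 4 ⊗ (0≤g ⊗ 0≤g)
        ⊕ 0≤+ 36 ⊗ (0≤s ⊗ 0≤f)
        ⊕ 0≤+ 4 ⊗ (0≤s ⊗ 0≤g)
        ⊕ 0≤+ 12 ⊗ (0≤f ⊗ 0≤g)))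
      where
      0≤f : 0ℤ ≤ d - (s + e)
      0≤f = ZP.i≤j⇒0≤j-i s+e≤d
      0≤g : 0ℤ ≤ e + e - T
      0≤g = ZP.i≤j⇒0≤j-i t≤2e
      identity₁ : ∀ s d e hn hs ht → let t = s + d; n = s + d + e in
        + 4 * ((n * n - hn - (t * n - ht) + (s * n - hs) + (t * t - ht) - (s * t - hs) + (s * s - hs))
            + (s * s - (n * (d + e) - hn)) + (e * e - (n * t - hn)) + (s * e - hs - (t * e - ht))
            + (d * (d + e) - ht + hs) + ((n * d - hn) - s * s)) ≡
        + 4 * (n * n) + + 4 * (n * s) - + 12 * (n * t) + + 12 * (t * t) + + 7 * (s * s) - + 12 * (s * t) + ((s * s - + 4 * hs))
      identity₁ = solve-∀
      identity₂ : ∀ s d e → let t = s + d; n = s + d + e; f = d - (s + e); g = e + e - t in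
        + 5 * (+ 4 * (n * n) + + 4 * (n * s) - + 12 * (n * t) + + 12 * (t * t) + + 7 * (s * s) - + 12 * (s * t)) ≡
        + 4 * (n * n) + (+ 11 * (s * s) + + 24 * (f * f) + + 4 * (g * g) + + 36 * (s * f) + + 4 * (s * g) + + 12 * (f * g))
      identity₂ = solve-∀

    -- Completing squares is enough here: after scaling by 3 the square in s splits off, after
    -- scaling by 17 the square in T, and a positive multiple of N² remains.
    balanced-late-red-short : Ample (bound A₁ B₁ C₃ G₁)
    balanced-late-red-short = ample {X = + 5 * (N * N) + + 4 * (N * s) - + 12 * (N * T) + + 11 * (T * T) + + 12 * (s * s) - + 16 * (s * T)}
      (identity₁ s d e hN hs hT)
      (subst (0ℤ ≤_) (swap (T * T - + 4 * hT) (N * N - + 4 * hN)) (0≤δT ⊕ 0≤1-δN))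
      (four-fifths (complement (+ 5 * (N * N) + + 4 * (N * s) - + 12 * (N * T) + + 11 * (T * T) + + 12 * (s * s) - + 16 * (s * T)) (N * N)) (scaled 2 (subst (0ℤ ≤_) (sym (identity₂ s d e))
        (0≤+ 5 ⊗ 0≤z² (+ 6 * s + N - + 4 * T) ⊕ scaled 16 (subst (0ℤ ≤_) (sym (identity₃ T N)) (0≤+ 5 ⊗ 0≤z² (+ 17 * T - + 14 * N) ⊕ 0≤+ 6 ⊗ 0≤z² N))))))
      where
      swap : ∀ a b → a + (+ 1 - b) ≡ + 1 + (a - b)
      swap = solve-∀
      complement : ∀ X m → + 5 * X ≡ + 4 * m + (+ 5 * X - + 4 * m)
      complement = solve-∀
      identity₁ : ∀ s d e hn hs ht → let t = s + d; n = s + d + e in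
        + 4 * ((n * n - hn - (t * n - ht) + (s * n - hs) + (t * t - ht) - (s * t - hs) + (s * s - hs))
            + (s * s - (n * (d + e) - hn)) + (e * e - (n * t - hn)) + (e * e - e * e)
            + (d * (d + e) - ht + hs) + (d * d - s * s)) ≡
        + 5 * (n * n) + + 4 * (n * s) - + 12 * (n * t) + + 11 * (t * t) + + 12 * (s * s) - + 16 * (s * t) + ((t * t - + 4 * ht) - (n * n - + 4 * hn))
      identity₁ = solve-∀
      identity₂ : ∀ s d e → let t = s + d; n = s + d + e in
        + 3 * (+ 5 * (+ 5 * (n * n) + + 4 * (n * s) - + 12 * (n * t) + + 11 * (t * t) + + 12 * (s * s) - + 16 * (s * t)) - + 4 * (n * n)) ≡
        + 5 * ((+ 6 * s + n - + 4 * t) * (+ 6 * s + n - + 4 * t)) + (+ 85 * (t * t) - + 140 * (t * n) + + 58 * (n * n))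
      identity₂ = solve-∀
      identity₃ : ∀ t n → + 17 * (+ 85 * (t * t) - + 140 * (t * n) + + 58 * (n * n)) ≡
        + 5 * ((+ 17 * t - + 14 * n) * (+ 17 * t - + 14 * n)) + + 6 * (n * n)
      identity₃ = solve-∀

    blue-dominant-late-red-medium : s + e ≤ d → s ≤ e + e → e + e ≤ T → Ample (bound A₁ B₁ C₂ G₂)
    blue-dominant-late-red-medium s+e≤d s≤2e 2e≤t = ample {X = + 2 * (s * s) - + 2 * (s * d) + + 3 * (d * d) + + 4 * (s * e)}
      (identity₁ s d e hN hs hT)
      (0≤+ 1 ⊕ (0≤δs ⊕ 0≤δT))
      (four-fifths (identity₂ s d e)
        (0≤s ⊗ (ZP.i≤j⇒0≤j-i s≤2e)
        ⊕ 0≤e ⊗ (ZP.i≤j⇒0≤j-i 2e≤t)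
        ⊕ 0≤+ 4 ⊗ (0≤s ⊗ 0≤e)
        ⊕ 0≤+ 4 ⊗ (0≤s ⊗ 0≤f)
        ⊕ 0≤+ 13 ⊗ (0≤e ⊗ 0≤f)
        ⊕ 0≤+ 11 ⊗ (0≤f ⊗ 0≤f)))
      where
      0≤f : 0ℤ ≤ d - (s + e)
      0≤f = ZP.i≤j⇒0≤j-i s+e≤d
      identity₁ : ∀ s d e hn hs ht → let t = s + d; n = s + d + e in
        + 4 * ((n * n - hn - (t * n - ht) + (s * n - hs) + (t * t - ht) - (s * t - hs) + (s * s - hs))
            + (s * s - (n * (d + e) - hn)) + (e * e - (n * t - hn)) + (s * e - hs - e * e)
            + (d * (d + e) - ht + hs) + ((n * d - hn) - s * s)) ≡
        + 2 * (s * s) - + 2 * (s * d) + + 3 * (d * d) + + 4 * (s * e) + ((s * s - + 4 * hs) + (t * t - + 4 * ht))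
      identity₁ = solve-∀
      identity₂ : ∀ s d e → let t = s + d; n = s + d + e; f = d - (s + e) in
        + 5 * (+ 2 * (s * s) - + 2 * (s * d) + + 3 * (d * d) + + 4 * (s * e)) ≡
        + 4 * (n * n) + (s * (e + e - s) + e * (t - (e + e)) + + 4 * (s * e) + + 4 * (s * f) + + 13 * (e * f) + + 11 * (f * f))
      identity₂ = solve-∀

    blue-dominant-late-red-short : Ample (bound A₁ B₁ C₃ G₂)
    blue-dominant-late-red-short = ample {X = + 4 * (N * N) - + 8 * (N * T) + + 7 * (T * T) + + 8 * (s * s) - + 8 * (s * T)}
      (identity₁ s d e hN hs hT)
      (0≤+ 1 ⊕ (0≤δT))
      (four-fifths (identity₂ s d e)
        (0≤+ 10 ⊗ 0≤z² (+ 2 * s - T)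
        ⊕ 0≤z² (+ 5 * T - + 4 * N)))
      where
      identity₁ : ∀ s d e hn hs ht → let t = s + d; n = s + d + e in
        + 4 * ((n * n - hn - (t * n - ht) + (s * n - hs) + (t * t - ht) - (s * t - hs) + (s * s - hs))
            + (s * s - (n * (d + e) - hn)) + (e * e - (n * t - hn)) + (e * e - e * e)
            + (d * (d + e) - ht + hs) + ((n * d - hn) - s * s)) ≡
        + 4 * (n * n) - + 8 * (n * t) + + 7 * (t * t) + + 8 * (s * s) - + 8 * (s * t) + ((t * t - + 4 * ht))
      identity₁ = solve-∀
      identity₂ : ∀ s d e → let t = s + d; n = s + d + e in
        + 5 * (+ 4 * (n * n) - + 8 * (n * t) + + 7 * (t * t) + + 8 * (s * s) - + 8 * (s * t)) ≡
        + 4 * (n * n) + (+ 10 * ((+ 2 * s - t) * (+ 2 * s - t)) + (+ 5 * t - + 4 * n) * (+ 5 * t - + 4 * n))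
      identity₂ = solve-∀

    -- The tightest region: with a = T − 2e ≥ 0 and b = 5e − T ≥ 0 one has N = 2a + b.
    balanced-late-red-medium : d ≤ s + e → s ≤ e + e → e + e ≤ T → Ample (bound A₁ B₁ C₂ G₁)
    balanced-late-red-medium d≤s+e s≤2e 2e≤t = ample {X = N * N + + 8 * (N * s) - + 4 * (N * T) + + 7 * (T * T) + + 11 * (s * s) - + 20 * (s * T)}
      (identity₁ s d e hN hs hT)
      (subst (0ℤ ≤_) (swap (s * s - + 4 * hs) (T * T - + 4 * hT) (N * N - + 4 * hN)) (0≤δs ⊕ 0≤δT ⊕ 0≤1-δN))
      (subst (0ℤ ≤_) (sym (identity₂ s d e)) (0≤+ 9 ⊗ 0≤z² (+ 11 * s - + 10 * T + + 4 * N) ⊕ subst (0ℤ ≤_) (sym (identity₃ s d e))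
        (0≤+ 9 ⊗ 0≤z² (T - (e + e)) ⊕ 0≤+ 16 ⊗ (ZP.i≤j⇒0≤j-i 2e≤t ⊗ (0≤+ 2 ⊗ ZP.i≤j⇒0≤j-i s≤2e ⊕ ZP.i≤j⇒0≤j-i d≤s+e)))))
      where
      swap : ∀ a b c → a + b + (+ 1 - c) ≡ + 1 + (a + b - c)
      swap = solve-∀
      identity₁ : ∀ s d e hn hs ht → let t = s + d; n = s + d + e in
        + 4 * ((n * n - hn - (t * n - ht) + (s * n - hs) + (t * t - ht) - (s * t - hs) + (s * s - hs))
            + (s * s - (n * (d + e) - hn)) + (e * e - (n * t - hn)) + (s * e - hs - e * e)
            + (d * (d + e) - ht + hs) + (d * d - s * s)) ≡
        n * n + + 8 * (n * s) - + 4 * (n * t) + + 7 * (t * t) + + 11 * (s * s) - + 20 * (s * t) + ((s * s - + 4 * hs) + (t * t - + 4 * ht) - (n * n - + 4 * hn))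
      identity₁ = solve-∀
      identity₂ : ∀ s d e → let t = s + d; n = s + d + e in
        + 99 * (n * n + + 8 * (n * s) - + 4 * (n * t) + + 7 * (t * t) + + 11 * (s * s) - + 20 * (s * t)) - + 79 * (n * n) ≡
        + 9 * ((+ 11 * s - + 10 * t + + 4 * n) * (+ 11 * s - + 10 * t + + 4 * n)) + (+ 324 * (t * n) - + 207 * (t * t) - + 124 * (n * n))
      identity₂ = solve-∀
      identity₃ : ∀ s d e → let t = s + d; n = s + d + e in
        + 324 * (t * n) - + 207 * (t * t) - + 124 * (n * n) ≡
        + 9 * ((t - (e + e)) * (t - (e + e))) + + 16 * ((t - (e + e)) * (+ 2 * (e + e - s) + (s + e - d)))
      identity₃ = solve-∀

-- M in terms of block lengths and the case split over the walls

module Blocks (s d e : ℕ) where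

  t n : ℕ
  t = s N.+ d
  n = s N.+ d N.+ e

  open Estimates (+ s) (+ d) (+ e) (h n) (h s) (h t) public

  private
    s≤t : s N.≤ t
    s≤t = NP.m≤m+n s d

    t≤n : t N.≤ n
    t≤n = NP.m≤m+n t e

    ≤2r+1 : ∀ {q r} → q N.≤ r → q N.≤ suc (r N.+ r)
    ≤2r+1 {q} {r} q≤r = NP.m≤n⇒m≤1+n (NP.≤-trans q≤r (NP.m≤m+n r r))

  M-as-base : + M n s t ≡ base + (k n s - k n (d N.+ e)) + (k n e - k n t) + (k s e - k t e) + (k t (d N.+ e) - k s (d N.+ e)) + (k n d - k t s)
  M-as-base = trans (M-as-K s d e) (cong (λ z → z + (k n s - k n (d N.+ e)) + (k n e - k n t) + (k s e - k t e) + (k t (d N.+ e) - k s (d N.+ e)) + (k n d - k t s))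
    (cong₂ _+_ (cong₂ _-_ (cong₂ _+_ (cong₂ _+_ (cong₂ _-_
      (k≡qr-h {n} n (≤2r+1 NP.≤-refl)) (k≡qr-h {t} n (≤2r+1 t≤n))) (k≡qr-h {s} n (≤2r+1 (NP.≤-trans s≤t t≤n))))
      (k≡qr-h {t} t (≤2r+1 NP.≤-refl))) (k≡qr-h {s} t (≤2r+1 s≤t))) (k≡qr-h {s} s (≤2r+1 NP.≤-refl))))

  bound≤M : ∀ {a b c g} → a ≤ k n s - k n (d N.+ e) → b ≤ k n e - k n t → c ≤ k s e - k t e → g ≤ k n d →
    bound a b c g ≤ + M n s t
  bound≤M {a} {b} {c} {g} a≤ b≤ c≤ g≤ = subst (bound a b c g ≤_) (sym M-as-base)
    (ZP.+-mono-≤ (ZP.+-mono-≤ (ZP.+-mono-≤ (ZP.+-mono-≤ (ZP.+-monoʳ-≤ base a≤) b≤) c≤) (k-increment s d (d N.+ e))) (-mono-≤ g≤ (k≤r² t s)))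

  module _ (s≤d+e : s N.≤ d N.+ e) where
    private
      2s≤n : s N.+ s N.≤ suc n
      2s≤n = NP.m≤n⇒m≤1+n (NP.≤-trans (NP.+-monoʳ-≤ s s≤d+e) (NP.≤-reflexive (sym (NP.+-assoc s d e))))
      n≤2[d+e] : n N.≤ suc (d N.+ e N.+ (d N.+ e))
      n≤2[d+e] = NP.m≤n⇒m≤1+n (NP.≤-trans (NP.≤-reflexive (NP.+-assoc s d e)) (NP.+-monoˡ-≤ (d N.+ e) s≤d+e))
    A₁≡ : A₁ ≡ k n s - k n (d N.+ e)
    A₁≡ = sym (cong₂ _-_ (k≡r² s 2s≤n) (k≡qr-h (d N.+ e) n≤2[d+e]))

  A₂≤ : A₂ ≤ k n s - k n (d N.+ e)
  A₂≤ = -mono-≤ (qr-h≤k n s) (k≤r² n (d N.+ e))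

  B₁≡ : e N.≤ t → B₁ ≡ k n e - k n t
  B₁≡ e≤t = sym (cong₂ _-_ (k≡r² e (NP.m≤n⇒m≤1+n (NP.+-monoˡ-≤ e e≤t))) (k≡qr-h t (NP.m≤n⇒m≤1+n (NP.+-monoʳ-≤ t e≤t))))

  B₂≤ : B₂ ≤ k n e - k n t
  B₂≤ = -mono-≤ (qr-h≤k n e) (k≤r² n t)

  C₁≡ : t N.≤ e N.+ e → C₁ ≡ k s e - k t e
  C₁≡ t≤2e = sym (cong₂ _-_ (k≡qr-h e (NP.m≤n⇒m≤1+n (NP.≤-trans s≤t t≤2e))) (k≡qr-h e (NP.m≤n⇒m≤1+n t≤2e)))

  C₂≤ : C₂ ≤ k s e - k t e
  C₂≤ = -mono-≤ (qr-h≤k s e) (k≤r² t e)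

  C₃≤ : e N.+ e N.≤ s → C₃ ≤ k s e - k t e
  C₃≤ 2e≤s = -mono-≤ (ZP.≤-reflexive (sym (k≡r² e (NP.m≤n⇒m≤1+n 2e≤s)))) (k≤r² t e)

  G₁≡ : d N.≤ s N.+ e → G₁ ≡ k n d
  G₁≡ d≤s+e = sym (k≡r² d (NP.m≤n⇒m≤1+n (NP.≤-trans (NP.+-monoʳ-≤ d d≤s+e) (NP.≤-reflexive (rotate s d e)))))
    where
    rotate : ∀ s d e → d N.+ (s N.+ e) ≡ s N.+ d N.+ e
    rotate = ℕ-solve-∀

  G₂≤ : G₂ ≤ k n d
  G₂≤ = qr-h≤k n d

  -- In this region the minimum of M is attained.
  record Balanced : Set where
    constructor balanced
    field
      s≤d+e : s N.≤ d N.+ e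
      e≤t   : e N.≤ t
      d≤s+e : d N.≤ s N.+ e
      t≤2e  : t N.≤ e N.+ e

  bound≡Q : bound A₁ B₁ C₁ G₁ ≡ Q
  bound≡Q = bound-Q (+ s) (+ d) (+ e) (h n) (h s) (h t)

  Q≤M : Balanced → Q ≤ + M n s t
  Q≤M (balanced s≤d+e e≤t d≤s+e t≤2e) = subst (_≤ + M n s t) bound≡Q
    (bound≤M (ZP.≤-reflexive (A₁≡ s≤d+e)) (ZP.≤-reflexive (B₁≡ e≤t)) (ZP.≤-reflexive (C₁≡ t≤2e)) (ZP.≤-reflexive (G₁≡ d≤s+e)))

  -- The two estimates shared by all regions become exact: t ≤ 2e gives t ≤ 2(d + e) for the
  -- increment, and s ≤ d gives 2s ≤ t, so that `k t s` is s².
  M≡Q : Balanced → s N.≤ d → + M n s t ≡ Q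
  M≡Q (balanced s≤d+e e≤t d≤s+e t≤2e) s≤d = trans M-as-base (trans
    (sym (cong₂ _+_ (cong₂ _+_ (cong₂ _+_ (cong₂ _+_ (cong₂ _+_ (refl {x = base}) (A₁≡ s≤d+e)) (B₁≡ e≤t)) (C₁≡ t≤2e)) increment) (cong₂ _-_ (G₁≡ d≤s+e) (sym (k≡r² s (NP.m≤n⇒m≤1+n (NP.+-monoʳ-≤ s s≤d)))))))
    bound≡Q)
    where
    e≤d+e : e N.≤ d N.+ e
    e≤d+e = NP.m≤n+m e d
    t≤2[d+e] : t N.≤ suc (d N.+ e N.+ (d N.+ e))
    t≤2[d+e] = NP.m≤n⇒m≤1+n (NP.≤-trans t≤2e (NP.+-mono-≤ e≤d+e e≤d+e))
    regroup : ∀ s d x ht hs → (s + d) * x - ht - (s * x - hs) ≡ d * x - ht + hs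
    regroup = solve-∀
    increment : + d * (+ d + + e) - h t + h s ≡ k t (d N.+ e) - k s (d N.+ e)
    increment = sym (trans (cong₂ _-_ (k≡qr-h (d N.+ e) t≤2[d+e]) (k≡qr-h (d N.+ e) (NP.≤-trans s≤t t≤2[d+e])))
      (regroup (+ s) (+ d) (+ (d N.+ e)) (h t) (h s)))

  -- The constant 5 is the least that suffices against `defect≤80`: 76 times the formula is at most
  -- 15 n² + 80, so M below the formula would force 76 M ≤ 15 n² + 4.
  Far : Set
  Far = + 15 * (+ n * + n) + + 5 ≤ + 76 * + M n s t

  balanced-or-far : 13 N.≤ n → Balanced ⊎ Far
  balanced-or-far 13≤n = cases (NP.≤-total t e) (NP.≤-total (d N.+ e) s) (NP.≤-total (s N.+ e) d) (NP.≤-total (e N.+ e) t) (NP.≤-total (e N.+ e) s)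
    where
    open Regions (+ s) (+ d) (+ e) (h n) (h s) (h t) (0≤+ s) (0≤+ d) (0≤+ e)

    -- Nineteen times `Ample` yields 76 b ≥ 15 n² + 16 n² / 99 - 19, and 16 n² / 99 ≥ 24 from n = 13
    -- on. The constant 328 is the surplus 16 · 169 - 99 · 24.
    far : ∀ {b} → Ample b → b ≤ + M n s t → Far
    far {b} ample b≤M = ZP.≤-trans
      (ZP.0≤i-j⇒j≤i (scaled 98 (subst (0ℤ ≤_) (regroup b (+ n * + n))
        (0≤+ 19 ⊗ ample ⊕ 0≤+ 16 ⊗ 0≤n²-169 13≤n ⊕ 0≤+ 328))))
      (ZP.*-monoˡ-≤-nonNeg (+ 76) b≤M)
      where
      regroup : ∀ b m → + 19 * (+ 99 * (+ 4 * b + + 1) - + 79 * m) + + 16 * (m - + 169) + + 328 ≡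
        + 99 * (+ 76 * b - (+ 15 * m + + 5))
      regroup = solve-∀

    region : ∀ {b} → (0ℤ ≤ + n * + n - + 4 * h n → 0ℤ ≤ + 1 - (+ n * + n - + 4 * h n) → 0ℤ ≤ + s * + s - + 4 * h s → 0ℤ ≤ + t * + t - + 4 * h t → Ample b) →
      b ≤ + M n s t → Far
    region ample = far (ample (0≤q²-4h n) (0≤1-q²+4h n) (0≤q²-4h s) (0≤q²-4h t))

    cases : t N.≤ e ⊎ e N.≤ t → d N.+ e N.≤ s ⊎ s N.≤ d N.+ e → s N.+ e N.≤ d ⊎ d N.≤ s N.+ e →
      e N.+ e N.≤ t ⊎ t N.≤ e N.+ e → e N.+ e N.≤ s ⊎ s N.≤ e N.+ e → Balanced ⊎ Far
    cases (inj₁ t≤e) _ _ _ _ = inj₂ (region (λ a b c d → late-red-dominant a b c d (+≤+ t≤e))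
      (bound≤M (ZP.≤-reflexive (A₁≡ (NP.≤-trans s≤t (NP.≤-trans t≤e (NP.m≤n+m e d))))) B₂≤
        (ZP.≤-reflexive (C₁≡ (NP.≤-trans t≤e (NP.m≤m+n e e))))
        (ZP.≤-reflexive (G₁≡ (NP.≤-trans (NP.m≤n+m d s) (NP.≤-trans t≤e (NP.m≤n+m e s)))))))
    cases (inj₂ e≤t) (inj₁ d+e≤s) _ _ (inj₁ 2e≤s) = inj₂ (region (λ a b c d → early-red-dominant-late-red-short a b c d (+≤+ d+e≤s))
      (bound≤M A₂≤ (ZP.≤-reflexive (B₁≡ e≤t)) (C₃≤ 2e≤s)
        (ZP.≤-reflexive (G₁≡ (NP.≤-trans (NP.m≤m+n d e) (NP.≤-trans d+e≤s (NP.m≤m+n s e)))))))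
    cases (inj₂ e≤t) (inj₁ d+e≤s) _ _ (inj₂ s≤2e) = inj₂ (region (λ a b c d → early-red-dominant-late-red-long a b c d (+≤+ d+e≤s) (+≤+ s≤2e))
      (bound≤M A₂≤ (ZP.≤-reflexive (B₁≡ e≤t)) C₂≤
        (ZP.≤-reflexive (G₁≡ (NP.≤-trans (NP.m≤m+n d e) (NP.≤-trans d+e≤s (NP.m≤m+n s e)))))))
    cases (inj₂ e≤t) (inj₂ s≤d+e) (inj₁ s+e≤d) (inj₂ t≤2e) _ = inj₂ (region (λ a b c d → blue-dominant-late-red-long a b c d (+≤+ s+e≤d) (+≤+ t≤2e))
      (bound≤M (ZP.≤-reflexive (A₁≡ s≤d+e)) (ZP.≤-reflexive (B₁≡ e≤t)) (ZP.≤-reflexive (C₁≡ t≤2e)) G₂≤))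
    cases (inj₂ e≤t) (inj₂ s≤d+e) (inj₁ s+e≤d) (inj₁ 2e≤t) (inj₁ 2e≤s) = inj₂ (region blue-dominant-late-red-short
      (bound≤M (ZP.≤-reflexive (A₁≡ s≤d+e)) (ZP.≤-reflexive (B₁≡ e≤t)) (C₃≤ 2e≤s) G₂≤))
    cases (inj₂ e≤t) (inj₂ s≤d+e) (inj₁ s+e≤d) (inj₁ 2e≤t) (inj₂ s≤2e) = inj₂ (region (λ a b c d → blue-dominant-late-red-medium a b c d (+≤+ s+e≤d) (+≤+ s≤2e) (+≤+ 2e≤t))
      (bound≤M (ZP.≤-reflexive (A₁≡ s≤d+e)) (ZP.≤-reflexive (B₁≡ e≤t)) C₂≤ G₂≤))
    cases (inj₂ e≤t) (inj₂ s≤d+e) (inj₂ d≤s+e) (inj₂ t≤2e) _ = inj₁ (balanced s≤d+e e≤t d≤s+e t≤2e)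
    cases (inj₂ e≤t) (inj₂ s≤d+e) (inj₂ d≤s+e) (inj₁ 2e≤t) (inj₁ 2e≤s) = inj₂ (region balanced-late-red-short
      (bound≤M (ZP.≤-reflexive (A₁≡ s≤d+e)) (ZP.≤-reflexive (B₁≡ e≤t)) (C₃≤ 2e≤s) (ZP.≤-reflexive (G₁≡ d≤s+e))))
    cases (inj₂ e≤t) (inj₂ s≤d+e) (inj₂ d≤s+e) (inj₁ 2e≤t) (inj₂ s≤2e) = inj₂ (region (λ a b c d → balanced-late-red-medium a b c d (+≤+ d≤s+e) (+≤+ s≤2e) (+≤+ 2e≤t))
      (bound≤M (ZP.≤-reflexive (A₁≡ s≤d+e)) (ZP.≤-reflexive (B₁≡ e≤t)) C₂≤ (ZP.≤-reflexive (G₁≡ d≤s+e))))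

-- The arithmetic of the formula

formula-38+ : ∀ n → formula (38 N.+ n) ≡ formula n + + 15 * (+ n + + 19)
formula-38+ n = begin
  -- The remainder of 38 + n modulo 38 computes to that of n, so `corr (38 + n)` is `corr n` by
  -- definition.
  + ((15 N.* (38 N.+ n) N.* (38 N.+ n) N.+ 72) N./ 76) + corr n
    ≡⟨ cong (λ m → + m + corr n) quotient ⟩
  + ((15 N.* n N.* n N.+ 72) N./ 76 N.+ 15 N.* (n N.+ 19)) + corr n
    ≡⟨ cong (λ m → + ((15 N.* n N.* n N.+ 72) N./ 76) + m + corr n) (ZP.pos-* 15 (n N.+ 19)) ⟩
  + ((15 N.* n N.* n N.+ 72) N./ 76) + + 15 * (+ n + + 19) + corr n
    ≡⟨ swap (+ ((15 N.* n N.* n N.+ 72) N./ 76)) (+ 15 * (+ n + + 19)) (corr n) ⟩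
  formula n + + 15 * (+ n + + 19)  ∎
  where
  open ≡-Reasoning
  swap : ∀ a b c → a + b + c ≡ a + c + b
  swap = solve-∀
  expand : ∀ c n → 15 N.* (c N.+ c N.+ n) N.* (c N.+ c N.+ n) N.+ 72 ≡ 15 N.* n N.* n N.+ 72 N.+ 15 N.* (n N.+ c) N.* (c N.+ c N.+ (c N.+ c))
  expand = ℕ-solve-∀
  quotient : (15 N.* (38 N.+ n) N.* (38 N.+ n) N.+ 72) N./ 76 ≡ (15 N.* n N.* n N.+ 72) N./ 76 N.+ 15 N.* (n N.+ 19)
  quotient = trans (DM./-congˡ (expand 19 n)) (trans (DM.+-distrib-/-∣ʳ (15 N.* n N.* n N.+ 72) {15 N.* (n N.+ 19) N.* 76} {76} (n∣m*n (15 N.* (n N.+ 19))))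
    (cong ((15 N.* n N.* n N.+ 72) N./ 76 N.+_) (DM.m*n/n≡m (15 N.* (n N.+ 19)) 76)))

defect : ℕ → ℤ
defect n = + 76 * formula n - + 15 * (+ n * + n)

-- Passing from n to n + 38 raises 15 n² by 76 · 15 (n + 19), an exact multiple of 76. The deviation
-- of the formula from 15 n² / 76 therefore depends only on n mod 38.
defect-periodic : ∀ r k → defect (r N.+ k N.* 38) ≡ defect r
defect-periodic r zero    = cong defect (NP.+-identityʳ r)
defect-periodic r (suc k) = begin
  defect (r N.+ (38 N.+ k N.* 38))     ≡⟨ cong defect (shuffle r (k N.* 38)) ⟩
  defect (38 N.+ (r N.+ k N.* 38))     ≡⟨ cong (λ f → + 76 * f - + 15 * ((+ 38 + + m) * (+ 38 + + m))) (formula-38+ m) ⟩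
  + 76 * (formula m + + 15 * (+ m + + 19)) - + 15 * ((+ 38 + + m) * (+ 38 + + m))  ≡⟨ cancel (formula m) (+ m) (+ 19) ⟩
  defect m                             ≡⟨ defect-periodic r k ⟩
  defect r  ∎
  where
  open ≡-Reasoning
  m : ℕ
  m = r N.+ k N.* 38
  shuffle : ∀ r c → r N.+ (38 N.+ c) ≡ 38 N.+ (r N.+ c)
  shuffle = ℕ-solve-∀
  cancel : ∀ f m c → (c + c + (c + c)) * (f + + 15 * (m + c)) - + 15 * ((c + c + m) * (c + c + m)) ≡ (c + c + (c + c)) * f - + 15 * (m * m)
  cancel = solve-∀

-- The parity of q.
ρ : ℕ → ℤ
ρ q = + q * + q - + 4 * h q

ρ-shift : ∀ r c → ρ (r N.+ r N.+ c) ≡ ρ c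
ρ-shift r c = trans (cong (λ z → + (r N.+ r N.+ c) * + (r N.+ r N.+ c) - + 4 * z) h-shift) (cancel (+ r) (+ c) (h c))
  where
  h-shift : h (r N.+ r N.+ c) ≡ + r * + r + + r * + c + h c
  h-shift = trans (cong +_ (quarter-shift r c)) (cong₂ (λ a b → a + b + h c) (ZP.pos-* r r) (ZP.pos-* r c))
  cancel : ∀ r c h → (r + r + c) * (r + r + c) - + 4 * (r * r + r * c + h) ≡ c * c - + 4 * h
  cancel = solve-∀

ρ-periodic : ∀ m r k → ρ (r N.+ k N.* (2 N.* m)) ≡ ρ r
ρ-periodic m r k = trans (cong ρ (regroup m r k)) (ρ-shift (k N.* m) r)
  where
  regroup : ∀ m r k → r N.+ k N.* (2 N.* m) ≡ k N.* m N.+ k N.* m N.+ r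
  regroup = ℕ-solve-∀

-- The integer minimum of Q

energy : (n s : ℕ) → ℤ → ℤ → ℤ
energy n s u v = + 19 * (v * v) + u * u + + 76 * (ρ s - ρ n)

U : (n s : ℤ) → ℤ
U n s = + 19 * s - + 4 * n

V : (n s t : ℤ) → ℤ
V n s t = + 8 * t - + 5 * s - + 4 * n

-- For j ≥ 0 the number a + j m is at least a; for j < 0 its negative is at least m - a.
sq-residue : ∀ {a m} → a N.≤ m → ∀ j → + (a ⊓ (m ∸ a)) * + (a ⊓ (m ∸ a)) ≤ (+ a + j * + m) * (+ a + j * + m)
sq-residue {a} {m} a≤m = go
  where
  w : ℕ
  w = m ∸ a
  square-mono : ∀ {x y} → x N.≤ y → + x * + x ≤ + y * + y
  square-mono {x} {y} x≤y = subst₂ _≤_ (ZP.pos-* x x) (ZP.pos-* y y) (+≤+ (NP.*-mono-≤ x≤y x≤y))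
  go : ∀ j → + (a ⊓ w) * + (a ⊓ w) ≤ (+ a + j * + m) * (+ a + j * + m)
  go (+ j) = subst (λ z → + (a ⊓ w) * + (a ⊓ w) ≤ (+ a + z) * (+ a + z)) (ZP.pos-* j m)
    (square-mono (NP.≤-trans (NP.m⊓n≤m a w) (NP.m≤m+n a (j N.* m))))
  go -[1+ j ] = subst (+ (a ⊓ w) * + (a ⊓ w) ≤_) reflect (square-mono (NP.≤-trans (NP.m⊓n≤n a w) (NP.m≤m+n w (j N.* m))))
    where
    negate : ∀ a w j → (w + j * (a + w)) * (w + j * (a + w)) ≡ (a + - (1ℤ + j) * (a + w)) * (a + - (1ℤ + j) * (a + w))
    negate = solve-∀
    m≡a+w : + m ≡ + a + + w
    m≡a+w = cong +_ (sym (NP.m+[n∸m]≡n a≤m))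
    reflect : + (w N.+ j N.* m) * + (w N.+ j N.* m) ≡ (+ a + -[1+ j ] * + m) * (+ a + -[1+ j ] * + m)
    reflect = trans (cong (λ z → (+ w + z) * (+ w + z)) (ZP.pos-* j m))
      (subst (λ z → (+ w + + j * z) * (+ w + + j * z) ≡ (+ a + -[1+ j ] * z) * (+ a + -[1+ j ] * z)) (sym m≡a+w) (negate (+ a) (+ w) (+ j)))

nearest : ℕ → (m : ℕ) .{{_ : N.NonZero m}} → ℕ
nearest x m = (x N.% m) ⊓ (m ∸ x N.% m)

nearest-sq : ∀ x m .{{_ : N.NonZero m}} j → + nearest x m * + nearest x m ≤ (+ x + j * + m) * (+ x + j * + m)
nearest-sq x m j = subst (λ z → + nearest x m * + nearest x m ≤ z * z) shift (sq-residue (DM.m%n≤n x m) (+ (x N./ m) + j))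
  where
  regroup : ∀ a q j m → a + (q + j) * m ≡ a + q * m + j * m
  regroup = solve-∀
  shift : + (x N.% m) + (+ (x N./ m) + j) * + m ≡ + x + j * + m
  shift = trans (regroup (+ (x N.% m)) (+ (x N./ m)) j (+ m)) (cong (_+ j * + m)
    (sym (trans (cong +_ (DM.m≡m%n+[m/n]*n x m)) (cong (λ z → + (x N.% m) + z) (ZP.pos-* (x N./ m) m)))))

-- For n = r + 38 l and s = b + 8 c the arguments of `nearest` are congruent to u modulo 152 and to
-- v modulo 8; the coefficients -4 and -5 are replaced by 148, 4 and 3 to stay in ℕ. Fixing b also
-- fixes the parity of s, so u² and v² can be bounded separately.
residue-check : ∀ {r} → r N.< 38 → ∀ {b} → b N.< 8 →
  + 4 * defect r ≤ energy r b (+ nearest (19 N.* b N.+ 148 N.* r) 152) (+ nearest (3 N.* b N.+ 4 N.* r) 8)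
residue-check = from-yes (NP.allUpTo? (λ r → NP.allUpTo? (λ b →
  + 4 * defect r Z.≤? energy r b (+ nearest (19 N.* b N.+ 148 N.* r) 152) (+ nearest (3 N.* b N.+ 4 N.* r) 8)) 8) 38)

defect≤energy : ∀ n s t → + 4 * defect n ≤ energy n s (U (+ n) (+ s)) (V (+ n) (+ s) t)
defect≤energy n s t = begin
  + 4 * defect n  ≡⟨ cong (λ z → + 4 * z) (trans (cong defect n≡) (defect-periodic r l)) ⟩
  + 4 * defect r  ≤⟨ residue-check (DM.m%n<n n 38) (DM.m%n<n s 8) ⟩
  energy r b (+ nearest x 152) (+ nearest y 8)
    ≤⟨ ZP.+-mono-≤ (ZP.+-mono-≤ (ZP.*-monoˡ-≤-nonNeg (+ 19) (nearest-sq y 8 j)) (nearest-sq x 152 i))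
         (ZP.≤-reflexive (cong₂ (λ p q → + 76 * (p - q)) (sym ρs) (sym ρn))) ⟩
  energy n s (+ x + i * + 152) (+ y + j * + 8)
    ≡⟨ cong₂ (energy n s) (sym U≡) (sym V≡) ⟩
  energy n s (U (+ n) (+ s)) (V (+ n) (+ s) t)  ∎
  where
  open ZP.≤-Reasoning
  r l b c x y : ℕ
  r = n N.% 38
  l = n N./ 38
  b = s N.% 8
  c = s N./ 8
  x = 19 N.* b N.+ 148 N.* r
  y = 3 N.* b N.+ 4 N.* r
  i j : ℤ
  i = + c - + l - + r
  j = t - + 5 * + c - + 19 * + l - + b - + r
  n≡ : n ≡ r N.+ l N.* 38
  n≡ = DM.m≡m%n+[m/n]*n n 38
  s≡ : s ≡ b N.+ c N.* 8
  s≡ = DM.m≡m%n+[m/n]*n s 8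
  ρn : ρ n ≡ ρ r
  ρn = trans (cong ρ n≡) (ρ-periodic 19 r l)
  ρs : ρ s ≡ ρ b
  ρs = trans (cong ρ s≡) (ρ-periodic 4 b c)
  n≡ℤ : + n ≡ + r + + l * + 38
  n≡ℤ = trans (cong +_ n≡) (cong (λ z → + r + z) (ZP.pos-* l 38))
  s≡ℤ : + s ≡ + b + + c * + 8
  s≡ℤ = trans (cong +_ s≡) (cong (λ z → + b + z) (ZP.pos-* c 8))
  reduce-U : ∀ r l b c → + 19 * (b + c * + 8) - + 4 * (r + l * + 38) ≡ + 19 * b + + 148 * r + (c - l - r) * + 152
  reduce-U = solve-∀
  reduce-V : ∀ r l b c t → + 8 * t - + 5 * (b + c * + 8) - + 4 * (r + l * + 38) ≡ + 3 * b + + 4 * r + (t - + 5 * c - + 19 * l - b - r) * + 8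
  reduce-V = solve-∀
  U≡ : U (+ n) (+ s) ≡ + x + i * + 152
  U≡ = trans (cong₂ U n≡ℤ s≡ℤ) (trans (reduce-U (+ r) (+ l) (+ b) (+ c))
    (cong (_+ i * + 152) (sym (cong₂ _+_ (ZP.pos-* 19 b) (ZP.pos-* 148 r)))))
  V≡ : V (+ n) (+ s) t ≡ + y + j * + 8
  V≡ = trans (cong₂ (λ m z → V m z t) n≡ℤ s≡ℤ) (trans (reduce-V (+ r) (+ l) (+ b) (+ c) t)
    (cong (_+ j * + 8) (sym (cong₂ _+_ (ZP.pos-* 3 b) (ZP.pos-* 4 r)))))

defect≤80 : ∀ n → defect n ≤ + 80
defect≤80 n = subst (_≤ + 80) (sym (trans (cong defect (DM.m≡m%n+[m/n]*n n 38)) (defect-periodic (n N.% 38) (n N./ 38))))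
  (from-yes (NP.allUpTo? (λ r → defect r Z.≤? + 80) 38) (DM.m%n<n n 38))

module _ (s d e : ℕ) where
  open Blocks s d e

  -- Completing the square in t takes the factor 16, then in s a further 19, whence 304 = 16 · 19.
  -- The leftover is 60 n², which is 4 · 15 n² and so matches 4 · `defect n`.
  Q-formula : + 304 * (Q - formula n) ≡ energy n s (U (+ n) (+ s)) (V (+ n) (+ s) (+ t)) - + 4 * defect n
  Q-formula = begin
    + 304 * (Q - formula n)  ≡⟨ split Q (formula n) ⟩
    + 19 * (+ 16 * Q) - + 304 * formula n  ≡⟨ cong (λ z → + 19 * z - + 304 * formula n) (square-V (+ n) (+ s) (+ t) (h n) (h s)) ⟩
    + 19 * (v * v + (+ 19 * (+ s * + s) - + 8 * (+ n * + s) + + 4 * (+ n * + n)) + + 4 * (ρ s - ρ n)) - + 304 * formula n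
      ≡⟨ distribute (v * v) (+ 19 * (+ s * + s) - + 8 * (+ n * + s) + + 4 * (+ n * + n)) (ρ s - ρ n) (formula n) ⟩
    + 19 * (v * v) + + 19 * (+ 19 * (+ s * + s) - + 8 * (+ n * + s) + + 4 * (+ n * + n)) + + 76 * (ρ s - ρ n) - + 4 * (+ 76 * formula n)
      ≡⟨ cong (λ z → + 19 * (v * v) + z + + 76 * (ρ s - ρ n) - + 4 * (+ 76 * formula n)) (square-U (+ n) (+ s)) ⟩
    + 19 * (v * v) + (u * u + + 60 * (+ n * + n)) + + 76 * (ρ s - ρ n) - + 4 * (+ 76 * formula n)
      ≡⟨ collect (+ 19 * (v * v)) (u * u) (+ n * + n) (+ 76 * (ρ s - ρ n)) (+ 76 * formula n) ⟩
    energy n s u v - + 4 * defect n  ∎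
    where
    open ≡-Reasoning
    u v : ℤ
    u = U (+ n) (+ s)
    v = V (+ n) (+ s) (+ t)
    split : ∀ q f → + 304 * (q - f) ≡ + 19 * (+ 16 * q) - + 304 * f
    split = solve-∀
    square-V : ∀ n s t hn hs → let v = + 8 * t - + 5 * s - + 4 * n in
      + 16 * (n * n + + 2 * (n * s) - + 4 * (n * t) + + 4 * (t * t) + + 3 * (s * s) - + 5 * (s * t) + hn - hs) ≡
      v * v + (+ 19 * (s * s) - + 8 * (n * s) + + 4 * (n * n)) + + 4 * (s * s - + 4 * hs - (n * n - + 4 * hn))
    square-V = solve-∀
    distribute : ∀ a b c f → + 19 * (a + b + + 4 * c) - + 304 * f ≡ + 19 * a + + 19 * b + + 76 * c - + 4 * (+ 76 * f)
    distribute = solve-∀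
    square-U : ∀ n s → let u = + 19 * s - + 4 * n in + 19 * (+ 19 * (s * s) - + 8 * (n * s) + + 4 * (n * n)) ≡ u * u + + 60 * (n * n)
    square-U = solve-∀
    collect : ∀ a b m c f → a + (b + + 60 * m) + c - + 4 * f ≡ a + b + c - + 4 * (f - + 15 * m)
    collect = solve-∀

  formula≤Q : formula n ≤ Q
  formula≤Q = ZP.0≤i-j⇒j≤i (scaled 303 (subst (0ℤ ≤_) (sym Q-formula) (ZP.i≤j⇒0≤j-i (defect≤energy n s (+ t)))))

  formula≤M : 13 N.≤ n → formula n ≤ + M n s t
  formula≤M 13≤n with balanced-or-far 13≤n
  ... | inj₁ bal = ZP.≤-trans formula≤Q (Q≤M bal)
  ... | inj₂ far = ZP.≮⇒≥ λ M<formula → ZP.<⇒≱ {+ 79} {+ 80} (Z.+<+ NP.≤-refl) (ZP.0≤i-j⇒j≤i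
    (subst (0ℤ ≤_) (slack (+ n * + n) (+ M n s t) (formula n))
      (ZP.i≤j⇒0≤j-i far ⊕ ZP.i≤j⇒0≤j-i (defect≤80 n) ⊕ 0≤+ 76 ⊗ ZP.i≤j⇒0≤j-i (ZP.i<j⇒suc[i]≤j M<formula))))
    where
    slack : ∀ m M f → + 76 * M - (+ 15 * m + + 5) + (+ 80 - (+ 76 * f - + 15 * m)) + + 76 * (f - (1ℤ + M)) ≡ + 79 - + 80
    slack = solve-∀

  M≡formula : Balanced → s N.≤ d → energy n s (U (+ n) (+ s)) (V (+ n) (+ s) (+ t)) ≡ + 4 * defect n → + M n s t ≡ formula n
  M≡formula bal s≤d E≡ = trans (M≡Q bal s≤d) (ZP.≤-antisym Q≤formula formula≤Q)
    where
    flip : ∀ q f → - (+ 304 * (q - f)) ≡ + 304 * (f - q)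
    flip = solve-∀
    Q≤formula : Q ≤ formula n
    Q≤formula = ZP.0≤i-j⇒j≤i (scaled 303 (ZP.≤-reflexive
      (trans (cong -_ (sym (trans Q-formula (ZP.i≡j⇒i-j≡0 E≡)))) (flip Q (formula n)))))

-- Colorings attaining the minimum

-- The minimizer of the quadratic form behind Q is (4/19, 8/19, 7/19) n; these are the nearest integers.
s₀ d₀ e₀ : ℕ → ℕ
s₀ n = (8 N.* n N.+ 19) N./ 38
d₀ n = (16 N.* n N.+ 19) N./ 38
e₀ n = n ∸ (s₀ n N.+ d₀ n)

record Minimizer (n s d e : ℕ) : Set where
  constructor minimizer
  field
    n≡s+d+e : n ≡ s N.+ d N.+ e
    1≤s     : 1 N.≤ s
    s≤d     : s N.≤ d
    s≤d+e   : s N.≤ d N.+ e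
    e≤t     : e N.≤ s N.+ d
    d≤s+e   : d N.≤ s N.+ e
    t≤2e    : s N.+ d N.≤ e N.+ e
    energy≡ : energy n s (U (+ n) (+ s)) (V (+ n) (+ s) (+ (s N.+ d))) ≡ + 4 * defect n

minimizer? : ∀ n s d e → Dec (Minimizer n s d e)
minimizer? n s d e = map′ (λ (a , b , c , d , e , f , g , h) → minimizer a b c d e f g h) (λ (minimizer a b c d e f g h) → a , b , c , d , e , f , g , h)
  (n N.≟ s N.+ d N.+ e ×-dec 1 N.≤? s ×-dec s N.≤? d ×-dec s N.≤? d N.+ e ×-dec e N.≤? s N.+ d ×-dec d N.≤? s N.+ e ×-dec s N.+ d N.≤? e N.+ e
    ×-dec energy n s (U (+ n) (+ s)) (V (+ n) (+ s) (+ (s N.+ d))) Z.≟ + 4 * defect n)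

-- One complete residue system modulo 38, starting at the threshold 13. The energy equality shows
-- that the lower bound is met in every class.
minimizer-base : ∀ {r} → r N.< 38 → Minimizer (13 N.+ r) (s₀ (13 N.+ r)) (d₀ (13 N.+ r)) (e₀ (13 N.+ r))
minimizer-base = from-yes (NP.allUpTo? (λ r → minimizer? (13 N.+ r) (s₀ (13 N.+ r)) (d₀ (13 N.+ r)) (e₀ (13 N.+ r))) 38)

-- The vector (8, 16, 14) is 38 · (4, 8, 7) / 19, a step along the ray u = v = 0. It leaves u and v
-- unchanged, alters s and n by even numbers and so preserves their parities, and satisfies the
-- balance inequalities itself, so adding multiples of it preserves them.
minimizer-shift : ∀ {n s d e} c → Minimizer n s d e → Minimizer (n N.+ c N.* 38) (s N.+ c N.* 8) (d N.+ c N.* 16) (e N.+ c N.* 14)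
minimizer-shift {n} {s} {d} {e} c (minimizer n≡ 1≤s s≤d s≤d+e e≤t d≤s+e t≤2e energy≡) = record
  { n≡s+d+e = trans (cong (N._+ c N.* 38) n≡) (total s d e c)
  ; 1≤s     = NP.≤-trans 1≤s (NP.m≤m+n s (c N.* 8))
  ; s≤d     = shift 8 16 s≤d
  ; s≤d+e   = subst (s N.+ c N.* 8 N.≤_) (d+e d e c) (shift 8 30 s≤d+e)
  ; e≤t     = subst (e N.+ c N.* 14 N.≤_) (s+d s d c) (shift 14 24 e≤t)
  ; d≤s+e   = subst (d N.+ c N.* 16 N.≤_) (s+e s e c) (shift 16 22 d≤s+e)
  ; t≤2e    = subst₂ N._≤_ (s+d s d c) (e+e e c) (shift 24 28 t≤2e)
  ; energy≡ = trans (cong₂ (λ p q → + 19 * (V′ * V′) + U′ * U′ + + 76 * (p - q)) (ρ-periodic 4 s c) (ρ-periodic 19 n c))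
      (trans (cong₂ (energy n s) U≡ V≡) (trans energy≡ (cong (λ z → + 4 * z) (sym (defect-periodic n c)))))
  }
  where
  shift : ∀ {a b} p q {p≤q : True (p N.≤? q)} → a N.≤ b → a N.+ c N.* p N.≤ b N.+ c N.* q
  shift p q {p≤q} a≤b = NP.+-mono-≤ a≤b (NP.*-monoʳ-≤ c (toWitness p≤q))
  total : ∀ s d e c → s N.+ d N.+ e N.+ c N.* 38 ≡ s N.+ c N.* 8 N.+ (d N.+ c N.* 16) N.+ (e N.+ c N.* 14)
  total = ℕ-solve-∀
  d+e : ∀ d e c → d N.+ e N.+ c N.* 30 ≡ d N.+ c N.* 16 N.+ (e N.+ c N.* 14)
  d+e = ℕ-solve-∀
  s+d : ∀ s d c → s N.+ d N.+ c N.* 24 ≡ s N.+ c N.* 8 N.+ (d N.+ c N.* 16)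
  s+d = ℕ-solve-∀
  s+e : ∀ s e c → s N.+ e N.+ c N.* 22 ≡ s N.+ c N.* 8 N.+ (e N.+ c N.* 14)
  s+e = ℕ-solve-∀
  e+e : ∀ e c → e N.+ e N.+ c N.* 28 ≡ e N.+ c N.* 14 N.+ (e N.+ c N.* 14)
  e+e = ℕ-solve-∀
  U′ V′ : ℤ
  U′ = U (+ (n N.+ c N.* 38)) (+ (s N.+ c N.* 8))
  V′ = V (+ (n N.+ c N.* 38)) (+ (s N.+ c N.* 8)) (+ (s N.+ c N.* 8 N.+ (d N.+ c N.* 16)))
  cancel-U : ∀ n s c → + 19 * (s + c * + 8) - + 4 * (n + c * + 38) ≡ + 19 * s - + 4 * n
  cancel-U = solve-∀
  cancel-V : ∀ n s d c → + 8 * (s + c * + 8 + (d + c * + 16)) - + 5 * (s + c * + 8) - + 4 * (n + c * + 38) ≡ + 8 * (s + d) - + 5 * s - + 4 * n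
  cancel-V = solve-∀
  U≡ : U′ ≡ U (+ n) (+ s)
  U≡ = trans (cong₂ (λ p q → U (+ n + p) (+ s + q)) (ZP.pos-* c 38) (ZP.pos-* c 8)) (cancel-U (+ n) (+ s) (+ c))
  V≡ : V′ ≡ V (+ n) (+ s) (+ (s N.+ d))
  V≡ = trans (cong₂ (λ p q → V (+ n + p) (+ s + q) (+ s + q + (+ d + + (c N.* 16)))) (ZP.pos-* c 38) (ZP.pos-* c 8))
    (trans (cong (λ p → V (+ n + + c * + 38) (+ s + + c * + 8) (+ s + + c * + 8 + (+ d + p))) (ZP.pos-* c 16)) (cancel-V (+ n) (+ s) (+ d) (+ c)))

-- Large n, small n and the theorem

Attained Bounded : ℕ → Set
Attained n = Σ ℕ (λ s → Σ ℕ (λ t → (1 N.≤ s) × (s N.≤ t) × (t N.≤ n) × (+ (M n s t) ≡ formula n)))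
Bounded n = (s t : ℕ) → 1 N.≤ s → s N.≤ t → t N.≤ n → formula n Z.≤ + (M n s t)

attained-large : ∀ m → Attained (13 N.+ m)
attained-large m = subst Attained (cong (13 N.+_) (sym (DM.m≡m%n+[m/n]*n m 38)))
  (attained-by (minimizer-shift (m N./ 38) (minimizer-base (DM.m%n<n m 38))))
  where
  attained-by : ∀ {n s d e} → Minimizer n s d e → Attained n
  attained-by {_} {s} {d} {e} (minimizer refl 1≤s s≤d s≤d+e e≤t d≤s+e t≤2e energy≡) =
    s , s N.+ d , 1≤s , NP.m≤m+n s d , NP.m≤m+n (s N.+ d) e ,
    M≡formula s d e (Blocks.balanced s≤d+e e≤t d≤s+e t≤2e) s≤d energy≡

bounded-large : ∀ n → 13 N.≤ n → Bounded n
bounded-large n 13≤n s t 1≤s s≤t t≤n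
  with d , refl ← NP.m≤n⇒∃[o]m+o≡n s≤t
  with e , refl ← NP.m≤n⇒∃[o]m+o≡n t≤n = formula≤M s d e 13≤n

attained-small : ∀ {n} → n N.< 13 → 1 N.≤ n → ∃ λ s → s N.< 13 × ∃ λ t → t N.< 13 × (1 N.≤ s) × (s N.≤ t) × (t N.≤ n) × (+ (M n s t) ≡ formula n)
attained-small = from-yes (NP.allUpTo? (λ n → 1 N.≤? n →-dec NP.anyUpTo? (λ s → NP.anyUpTo? (λ t →
  1 N.≤? s ×-dec s N.≤? t ×-dec t N.≤? n ×-dec + (M n s t) Z.≟ formula n) 13) 13) 13)

bounded-small : ∀ {n} → n N.< 13 → ∀ {s} → s N.< 13 → ∀ {t} → t N.< 13 → 1 N.≤ s → s N.≤ t → t N.≤ n → formula n Z.≤ + (M n s t)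
bounded-small = from-yes (NP.allUpTo? (λ n → NP.allUpTo? (λ s → NP.allUpTo? (λ t →
  1 N.≤? s →-dec (s N.≤? t →-dec (t N.≤? n →-dec formula n Z.≤? + (M n s t)))) 13) 13) 13)

attained : ∀ n → 1 N.≤ n → Attained n
attained n 1≤n with NP.<-≤-connex n 13
... | inj₁ n<13 = forget (attained-small n<13 1≤n)
  where
  forget : (∃ λ s → s N.< 13 × ∃ λ t → t N.< 13 × (1 N.≤ s) × (s N.≤ t) × (t N.≤ n) × (+ (M n s t) ≡ formula n)) → Attained n
  forget (s , _ , t , _ , p) = s , t , p
... | inj₂ 13≤n = subst Attained (NP.m+[n∸m]≡n 13≤n) (attained-large (n ∸ 13))

bounded : ∀ n → Bounded n
bounded n s t 1≤s s≤t t≤n with NP.<-≤-connex n 13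
... | inj₁ n<13 = bounded-small n<13 (NP.≤-<-trans s≤t t<13) t<13 1≤s s≤t t≤n
  where
  t<13 : t N.< 13
  t<13 = NP.≤-<-trans t≤n n<13
... | inj₂ 13≤n = bounded-large n 13≤n s t 1≤s s≤t t≤n

theorem5 : (n : ℕ) → 1 N.≤ n →
    Σ ℕ (λ s → Σ ℕ (λ t → (1 N.≤ s) × (s N.≤ t) × (t N.≤ n) × (+ (M n s t) ≡ formula n)))
    × ((s t : ℕ) → 1 N.≤ s → s N.≤ t → t N.≤ n → formula n Z.≤ + (M n s t))
theorem5 n 1≤n = attained n 1≤n , bounded n
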